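{- There exists an absolute constant $c>0$ such that for all integers $n,m\ge1$ and all functions $f_1,f_2,\dots,f_n:\{ -1,+1\}^m\to\{ -1,+1\}$, every quantum query algorithm that computes $f_1\otimes\cdots\otimes f_n$ with probability $4/5$ (i.e., on every input the output is correct with probability at least $4/5$) has cost at least $$c\sum_{i=1}^n\deg_{1/5}(f_i).$$
   Context: $f_1\otimes\cdots\otimes f_n:(\{ -1,+1\}^m)^n\to\{ -1,+1\}$ is given by $(x_1,\dots,x_n)\mapsto\prod_{i=1}^n f_i(x_i)$ (the XOR of the $f_i$ on independent inputs). For $f:\{ -1,+1\}^m\to\{ -1,+1\}$, $\deg_\epsilon(f)$ is the least degree of a real polynomial $p$ with $|f(x)-p(x)|\le\epsilon$ for all $x\in\{ -1,+1\}^m$. A quantum query algorithm with $T$ queries on unknown input $x\in\{ -1,+1\}^N$ starts in a fixed state, applies $U_TO_xU_{T-1}O_x\cdots U_1O_xU_0$, where the $U_j$ are input-independent unitaries and $O_x$ is the input oracle (mapping $|i,b,w\rangle$ to $|i,b\oplus b_i,w\rangle$ with $b_i=1$ if $x_i=-1$ and $b_i=0$ if $x_i=+1$), and outputs the result of a measurement. Its cost is the number $T$ of queries. Here $N=nm$. -}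

module Defs where

open import Algebra.Bundles.Raw using (RawRing)
import Algebra.Definitions.RawMonoid as RawMonoidDefs
import Algebra.Definitions.RawSemiring as RawSemiringDefs
open import Data.Bool.Base using (Bool; true; false; _xor_; if_then_else_)
import Data.Bool.Properties as Bool
open import Data.Fin.Base using (Fin; zero; suc; combine; fromℕ; inject₁)
import Data.Fin.Properties as Fin
open import Data.Integer.Base using (+_)
open import Data.List.Base as List using (List)
open import Data.List.Relation.Unary.All using (All)
open import Data.Nat.Base as ℕ using (ℕ; zero; suc)
import Data.Nat.Properties as ℕ
open import Data.Product.Base using (∃-syntax; _×_; _,_; proj₁; proj₂)
import Data.Product.Properties as Product
open import Data.Rational.Base as ℚ using (ℚ; 0ℚ; 1ℚ)
import Data.Rational.Properties as ℚ
open import Data.Sign.Base as Sign using (Sign)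
open import Data.Sum.Base using (_⊎_; inj₁; inj₂)
open import Data.Vec.Base as Vec using (Vec)
open import Data.Vec.Functional using (Vector)
open import Function.Base using (_∘_)
open import Function.Bundles using (mk⇔)
open import Level using (0ℓ)
open import Relation.Binary.Definitions using (DecidableEquality)
open import Relation.Binary.PropositionalEquality
  using (_≡_; refl; sym; trans; cong; subst)
open import Relation.Nullary.Decidable using (does; does-⇔; dec⇒maybe)
open import Tactic.RingSolver using (solve-∀)
import Tactic.RingSolver.Core.AlmostCommutativeRing as ACR

-- A real number is a Cauchy sequence of rationals; sequences with the same
-- limit are identified by _≈ℝ_ rather than by _≡_.

Cauchy : (ℕ → ℚ) → Set
Cauchy x = ∀ ε → 0ℚ ℚ.< ε →
  ∃[ N ] (∀ i j → N ℕ.≤ i → N ℕ.≤ j → ℚ.∣ x i ℚ.- x j ∣ ℚ.< ε)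

record ℝ : Set where
  constructor mkℝ
  field
    seq    : ℕ → ℚ
    cauchy : Cauchy seq

open ℝ public

infix 4 _≈ℝ_ _≤ℝ_ _<ℝ_

record _≈ℝ_ (x y : ℝ) : Set where
  constructor mk≈ℝ
  field
    eventually≈ : ∀ ε → 0ℚ ℚ.< ε →
      ∃[ N ] (∀ i → N ℕ.≤ i → ℚ.∣ seq x i ℚ.- seq y i ∣ ℚ.< ε)

record _≤ℝ_ (x y : ℝ) : Set where
  constructor mk≤ℝ
  field
    eventually≤ : ∀ ε → 0ℚ ℚ.< ε →
      ∃[ N ] (∀ i → N ℕ.≤ i → seq x i ℚ.≤ seq y i ℚ.+ ε)

record _<ℝ_ (x y : ℝ) : Set where
  constructor mk<ℝ
  field
    eventually< : ∃[ ε ] 0ℚ ℚ.< ε ×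
      ∃[ N ] (∀ i → N ℕ.≤ i → seq x i ℚ.+ ε ℚ.≤ seq y i)

open _≈ℝ_ public
open _≤ℝ_ public
open _<ℝ_ public

private
  ℚ-ring : ACR.AlmostCommutativeRing 0ℓ 0ℓ
  ℚ-ring = ACR.fromCommutativeRing ℚ.+-*-commutativeRing
    λ q → dec⇒maybe (0ℚ ℚ.≟ q)

  half-pos : ∀ {ε} → 0ℚ ℚ.< ε → 0ℚ ℚ.< ℚ.½ ℚ.* ε
  half-pos 0<ε = ℚ.*-monoʳ-<-pos ℚ.½ 0<ε

  halves : ∀ ε → ℚ.½ ℚ.* ε ℚ.+ ℚ.½ ℚ.* ε ≡ ε
  halves ε = trans (sym (ℚ.*-distribʳ-+ ε ℚ.½ ℚ.½)) (ℚ.*-identityˡ ε)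

  +-rearrange : ∀ a b c d → (a ℚ.+ b) ℚ.- (c ℚ.+ d) ≡ (a ℚ.- c) ℚ.+ (b ℚ.- d)
  +-rearrange = solve-∀ ℚ-ring

  *-rearrange : ∀ a b c d →
    a ℚ.* b ℚ.- c ℚ.* d ≡ a ℚ.* (b ℚ.- d) ℚ.+ d ℚ.* (a ℚ.- c)
  *-rearrange = solve-∀ ℚ-ring

  neg-rearrange : ∀ a b → ℚ.- a ℚ.- ℚ.- b ≡ ℚ.- (a ℚ.- b)
  neg-rearrange = solve-∀ ℚ-ring

  -‿swap : ∀ a b → ℚ.- (a ℚ.- b) ≡ b ℚ.- a
  -‿swap = solve-∀ ℚ-ring

  -‿cancel : ∀ a b → (a ℚ.- b) ℚ.+ b ≡ a
  -‿cancel = solve-∀ ℚ-ring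

  +‿cancel : ∀ a b → (a ℚ.+ b) ℚ.- b ≡ a
  +‿cancel = solve-∀ ℚ-ring

  ∣-∣-swap : ∀ a b → ℚ.∣ a ℚ.- b ∣ ≡ ℚ.∣ b ℚ.- a ∣
  ∣-∣-swap a b =
    trans (sym (ℚ.∣-p∣≡∣p∣ (a ℚ.- b))) (cong ℚ.∣_∣ (-‿swap a b))

  ∣-∣-shift : ∀ a b → ℚ.∣ a ∣ ℚ.≤ ℚ.∣ a ℚ.- b ∣ ℚ.+ ℚ.∣ b ∣
  ∣-∣-shift a b = subst (λ t → ℚ.∣ t ∣ ℚ.≤ ℚ.∣ a ℚ.- b ∣ ℚ.+ ℚ.∣ b ∣)
    (-‿cancel a b) (ℚ.∣p+q∣≤∣p∣+∣q∣ (a ℚ.- b) b)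

  ∣-∣-diff : ∀ a b → ℚ.∣ a ∣ ℚ.- ℚ.∣ b ∣ ℚ.≤ ℚ.∣ a ℚ.- b ∣
  ∣-∣-diff a b = subst (ℚ.∣ a ∣ ℚ.- ℚ.∣ b ∣ ℚ.≤_)
    (+‿cancel ℚ.∣ a ℚ.- b ∣ ℚ.∣ b ∣)
    (ℚ.+-monoˡ-≤ (ℚ.- ℚ.∣ b ∣) (∣-∣-shift a b))

  ∣-∣-contract : ∀ a b → ℚ.∣ ℚ.∣ a ∣ ℚ.- ℚ.∣ b ∣ ∣ ℚ.≤ ℚ.∣ a ℚ.- b ∣
  ∣-∣-contract a b with ℚ.∣p∣≡p∨∣p∣≡-p (ℚ.∣ a ∣ ℚ.- ℚ.∣ b ∣)
  ... | inj₁ eq = subst (ℚ._≤ ℚ.∣ a ℚ.- b ∣) (sym eq) (∣-∣-diff a b)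
  ... | inj₂ eq = subst (ℚ._≤ ℚ.∣ a ℚ.- b ∣)
    (sym (trans eq (-‿swap ℚ.∣ a ∣ ℚ.∣ b ∣)))
    (subst (ℚ.∣ b ∣ ℚ.- ℚ.∣ a ∣ ℚ.≤_) (∣-∣-swap b a) (∣-∣-diff b a))

  bounded : ∀ {x} → Cauchy x →
    ∃[ B ] 0ℚ ℚ.< B × ∃[ N ] (∀ i → N ℕ.≤ i → ℚ.∣ x i ∣ ℚ.≤ B)
  bounded {x} cx with cx 1ℚ (ℚ.positive⁻¹ 1ℚ)
  ... | N , near =
    1ℚ ℚ.+ ℚ.∣ x N ∣ ,
    ℚ.+-mono-<-≤ (ℚ.positive⁻¹ 1ℚ) (ℚ.0≤∣p∣ (x N)) ,
    N ,
    λ i N≤i → ℚ.≤-trans (∣-∣-shift (x i) (x N))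
      (ℚ.+-monoˡ-≤ ℚ.∣ x N ∣ (ℚ.<⇒≤ (near i N N≤i ℕ.≤-refl)))

  *-bound : ∀ {a b A e} → ℚ.∣ a ∣ ℚ.≤ A → ℚ.∣ b ∣ ℚ.< e → 0ℚ ℚ.< A →
    ℚ.∣ a ℚ.* b ∣ ℚ.< A ℚ.* e
  *-bound {a} {b} {A} {e} ∣a∣≤A ∣b∣<e 0<A = begin-strict
    ℚ.∣ a ℚ.* b ∣
      ≡⟨ ℚ.∣p*q∣≡∣p∣*∣q∣ a b ⟩
    ℚ.∣ a ∣ ℚ.* ℚ.∣ b ∣
      ≤⟨ ℚ.*-monoʳ-≤-nonNeg ℚ.∣ b ∣ {{ℚ.∣-∣-nonNeg b}} ∣a∣≤A ⟩
    A ℚ.* ℚ.∣ b ∣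
      <⟨ ℚ.*-monoʳ-<-pos A {{ℚ.positive 0<A}} ∣b∣<e ⟩
    A ℚ.* e ∎
    where open ℚ.≤-Reasoning

  split-tolerance : ∀ A B ε → 0ℚ ℚ.< A → 0ℚ ℚ.< B → 0ℚ ℚ.< ε →
    ∃[ δ ] 0ℚ ℚ.< δ × A ℚ.* δ ℚ.+ B ℚ.* δ ≡ ε
  split-tolerance A B ε 0<A 0<B 0<ε = divide (A ℚ.+ B) (ℚ.+-mono-< 0<A 0<B) refl
    where
    divide : ∀ C → 0ℚ ℚ.< C → C ≡ A ℚ.+ B →
      ∃[ δ ] 0ℚ ℚ.< δ × A ℚ.* δ ℚ.+ B ℚ.* δ ≡ ε
    divide C 0<C C≡A+B = r ℚ.* ε , 0<rε ,
      trans (sym (ℚ.*-distribʳ-+ (r ℚ.* ε) A B))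
        (trans (cong (ℚ._* (r ℚ.* ε)) (sym C≡A+B))
          (trans (sym (ℚ.*-assoc C r ε))
            (trans (cong (ℚ._* ε) (ℚ.*-inverseʳ C {{nz}})) (ℚ.*-identityˡ ε))))
      where
      nz : ℚ.NonZero C
      nz = ℚ.pos⇒nonZero C {{ℚ.positive 0<C}}
      r : ℚ
      r = ℚ.1/_ C {{nz}}
      0<rε : 0ℚ ℚ.< r ℚ.* ε
      0<rε = ℚ.positive⁻¹ (r ℚ.* ε)
        {{ℚ.pos*pos⇒pos r {{ℚ.1/pos⇒pos C {{ℚ.positive 0<C}}}} ε {{ℚ.positive 0<ε}}}}

  *-close : ∀ {a b c d A B δ} → 0ℚ ℚ.< A → 0ℚ ℚ.< B →
    ℚ.∣ a ∣ ℚ.≤ A → ℚ.∣ d ∣ ℚ.≤ B →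
    ℚ.∣ a ℚ.- c ∣ ℚ.< δ → ℚ.∣ b ℚ.- d ∣ ℚ.< δ →
    ℚ.∣ a ℚ.* b ℚ.- c ℚ.* d ∣ ℚ.< A ℚ.* δ ℚ.+ B ℚ.* δ
  *-close {a} {b} {c} {d} {A} {B} {δ} 0<A 0<B ∣a∣≤A ∣d∣≤B ac bd = begin-strict
    ℚ.∣ a ℚ.* b ℚ.- c ℚ.* d ∣
      ≡⟨ cong ℚ.∣_∣ (*-rearrange a b c d) ⟩
    ℚ.∣ a ℚ.* (b ℚ.- d) ℚ.+ d ℚ.* (a ℚ.- c) ∣
      ≤⟨ ℚ.∣p+q∣≤∣p∣+∣q∣ (a ℚ.* (b ℚ.- d)) (d ℚ.* (a ℚ.- c)) ⟩
    ℚ.∣ a ℚ.* (b ℚ.- d) ∣ ℚ.+ ℚ.∣ d ℚ.* (a ℚ.- c) ∣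
      <⟨ ℚ.+-mono-< (*-bound {a} {b ℚ.- d} ∣a∣≤A bd 0<A)
                    (*-bound {d} {a ℚ.- c} ∣d∣≤B ac 0<B) ⟩
    A ℚ.* δ ℚ.+ B ℚ.* δ ∎
    where open ℚ.≤-Reasoning

  -- Abstract because unfolding these moduli makes type checking very slow.
  abstract
    const-cauchy : ∀ q → Cauchy (λ _ → q)
    const-cauchy q ε 0<ε = 0 , λ _ _ _ _ →
      subst (ℚ._< ε) (sym (cong ℚ.∣_∣ (ℚ.+-inverseʳ q))) 0<ε

    neg-cauchy : ∀ {x} → Cauchy x → Cauchy (λ i → ℚ.- x i)
    neg-cauchy {x} cx ε 0<ε = proj₁ (cx ε 0<ε) , λ i j ≤i ≤j →
      subst (ℚ._< ε)
        (sym (trans (cong ℚ.∣_∣ (neg-rearrange (x i) (x j)))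
                    (ℚ.∣-p∣≡∣p∣ (x i ℚ.- x j))))
        (proj₂ (cx ε 0<ε) i j ≤i ≤j)

    ∣-∣-cauchy : ∀ {x} → Cauchy x → Cauchy (λ i → ℚ.∣ x i ∣)
    ∣-∣-cauchy {x} cx ε 0<ε = proj₁ (cx ε 0<ε) , λ i j ≤i ≤j →
      ℚ.≤-<-trans (∣-∣-contract (x i) (x j)) (proj₂ (cx ε 0<ε) i j ≤i ≤j)

    +-cauchy : ∀ {x y} → Cauchy x → Cauchy y → Cauchy (λ i → x i ℚ.+ y i)
    +-cauchy {x} {y} cx cy ε 0<ε
      with cx (ℚ.½ ℚ.* ε) (half-pos 0<ε) | cy (ℚ.½ ℚ.* ε) (half-pos 0<ε)
    ... | M , nearx | N , neary = M ℕ.⊔ N , λ i j ≤i ≤j → begin-strict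
      ℚ.∣ (x i ℚ.+ y i) ℚ.- (x j ℚ.+ y j) ∣
        ≡⟨ cong ℚ.∣_∣ (+-rearrange (x i) (y i) (x j) (y j)) ⟩
      ℚ.∣ (x i ℚ.- x j) ℚ.+ (y i ℚ.- y j) ∣
        ≤⟨ ℚ.∣p+q∣≤∣p∣+∣q∣ (x i ℚ.- x j) (y i ℚ.- y j) ⟩
      ℚ.∣ x i ℚ.- x j ∣ ℚ.+ ℚ.∣ y i ℚ.- y j ∣
        <⟨ ℚ.+-mono-<
             (nearx i j (ℕ.m⊔n≤o⇒m≤o M N ≤i) (ℕ.m⊔n≤o⇒m≤o M N ≤j))
             (neary i j (ℕ.m⊔n≤o⇒n≤o M N ≤i) (ℕ.m⊔n≤o⇒n≤o M N ≤j)) ⟩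
      ℚ.½ ℚ.* ε ℚ.+ ℚ.½ ℚ.* ε
        ≡⟨ halves ε ⟩
      ε ∎
      where open ℚ.≤-Reasoning

    *-cauchy : ∀ {x y} → Cauchy x → Cauchy y → Cauchy (λ i → x i ℚ.* y i)
    *-cauchy {x} {y} cx cy ε 0<ε = from-bounds (bounded {x} cx) (bounded {y} cy)
      where
      Goal : Set
      Goal = ∃[ N ] (∀ i j → N ℕ.≤ i → N ℕ.≤ j →
        ℚ.∣ x i ℚ.* y i ℚ.- x j ℚ.* y j ∣ ℚ.< ε)

      from-bounds :
        ∃[ A ] 0ℚ ℚ.< A × ∃[ K ] (∀ i → K ℕ.≤ i → ℚ.∣ x i ∣ ℚ.≤ A) →
        ∃[ B ] 0ℚ ℚ.< B × ∃[ L ] (∀ i → L ℕ.≤ i → ℚ.∣ y i ∣ ℚ.≤ B) → Goal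
      from-bounds (A , 0<A , K , ∣x∣≤A) (B , 0<B , L , ∣y∣≤B) =
        from-tolerance (split-tolerance A B ε 0<A 0<B 0<ε)
        where
        from-tolerance : ∃[ δ ] 0ℚ ℚ.< δ × A ℚ.* δ ℚ.+ B ℚ.* δ ≡ ε → Goal
        from-tolerance (δ , 0<δ , eq) = from-moduli (cx δ 0<δ) (cy δ 0<δ)
          where
          from-moduli :
            ∃[ M ] (∀ i j → M ℕ.≤ i → M ℕ.≤ j → ℚ.∣ x i ℚ.- x j ∣ ℚ.< δ) →
            ∃[ N ] (∀ i j → N ℕ.≤ i → N ℕ.≤ j → ℚ.∣ y i ℚ.- y j ∣ ℚ.< δ) → Goal
          from-moduli (M , nearx) (N , neary) =
            (M ℕ.⊔ N) ℕ.⊔ (K ℕ.⊔ L) , λ i j ≤i ≤j →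
            subst (ℚ.∣ x i ℚ.* y i ℚ.- x j ℚ.* y j ∣ ℚ.<_) eq
              (*-close {x i} {y i} {x j} {y j} 0<A 0<B
                (∣x∣≤A i (ℕ.m⊔n≤o⇒m≤o K L (ℕ.m⊔n≤o⇒n≤o (M ℕ.⊔ N) (K ℕ.⊔ L) ≤i)))
                (∣y∣≤B j (ℕ.m⊔n≤o⇒n≤o K L (ℕ.m⊔n≤o⇒n≤o (M ℕ.⊔ N) (K ℕ.⊔ L) ≤j)))
                (nearx i j
                  (ℕ.m⊔n≤o⇒m≤o M N (ℕ.m⊔n≤o⇒m≤o (M ℕ.⊔ N) (K ℕ.⊔ L) ≤i))
                  (ℕ.m⊔n≤o⇒m≤o M N (ℕ.m⊔n≤o⇒m≤o (M ℕ.⊔ N) (K ℕ.⊔ L) ≤j)))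
                (neary i j
                  (ℕ.m⊔n≤o⇒n≤o M N (ℕ.m⊔n≤o⇒m≤o (M ℕ.⊔ N) (K ℕ.⊔ L) ≤i))
                  (ℕ.m⊔n≤o⇒n≤o M N (ℕ.m⊔n≤o⇒m≤o (M ℕ.⊔ N) (K ℕ.⊔ L) ≤j))))

infixl 6 _+ℝ_ _-ℝ_
infixl 7 _*ℝ_
infix 8 -ℝ_

fromℚ : ℚ → ℝ
fromℚ q = mkℝ (λ _ → q) (const-cauchy q)

fromℕℝ : ℕ → ℝ
fromℕℝ n = fromℚ (+ n ℚ./ 1)

_+ℝ_ : ℝ → ℝ → ℝ
x +ℝ y = mkℝ (λ i → seq x i ℚ.+ seq y i) (+-cauchy {seq x} {seq y} (cauchy x) (cauchy y))

_*ℝ_ : ℝ → ℝ → ℝ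
x *ℝ y = mkℝ (λ i → seq x i ℚ.* seq y i) (*-cauchy {seq x} {seq y} (cauchy x) (cauchy y))

-ℝ_ : ℝ → ℝ
-ℝ x = mkℝ (λ i → ℚ.- seq x i) (neg-cauchy {seq x} (cauchy x))

_-ℝ_ : ℝ → ℝ → ℝ
x -ℝ y = x +ℝ (-ℝ y)

∣_∣ℝ : ℝ → ℝ
∣ x ∣ℝ = mkℝ (λ i → ℚ.∣ seq x i ∣) (∣-∣-cauchy {seq x} (cauchy x))

0ℝ 1ℝ : ℝ
0ℝ = fromℚ 0ℚ
1ℝ = fromℚ 1ℚ

ℝ-rawRing : RawRing 0ℓ 0ℓ
ℝ-rawRing = record
  { _≈_ = _≈ℝ_ ; _+_ = _+ℝ_ ; _*_ = _*ℝ_ ; -_ = -ℝ_ ; 0# = 0ℝ ; 1# = 1ℝ }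

open RawSemiringDefs (RawRing.rawSemiring ℝ-rawRing) public
  using () renaming (sum to sumℝ; product to productℝ; _^_ to _^ℝ_)

open RawMonoidDefs ℕ.+-0-rawMonoid public
  using () renaming (sum to sumℕ)

BoolFn : ℕ → Set
BoolFn m = Vec Sign m → Sign

signℝ : Sign → ℝ
signℝ Sign.+ = 1ℝ
signℝ Sign.- = -ℝ 1ℝ

open RawMonoidDefs Sign.*-1-rawMonoid public
  using () renaming (sum to productSign)

-- A point of ({-1,+1}^m)^n is stored as one vector of length n * m, made
-- of n consecutive blocks of length m.
block : ∀ {n m} → Fin n → Vec Sign (n ℕ.* m) → Vec Sign m
block i x = Vec.tabulate λ j → Vec.lookup x (combine i j)

⨂ : ∀ {n m} → (Fin n → BoolFn m) → BoolFn (n ℕ.* m)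
⨂ f x = productSign λ i → f i (block i x)

-- A polynomial in m variables is a finite formal sum of terms
-- (coefficient , exponents).  Terms may repeat or cancel, so only upper
-- bounds on the degree are read off; a polynomial has degree at most d
-- exactly when it is represented by terms of total degree at most d.
Poly : ℕ → Set
Poly m = List (ℝ × Vector ℕ m)

evalTerm : ∀ {m} → ℝ × Vector ℕ m → Vector ℝ m → ℝ
evalTerm (a , e) x = a *ℝ productℝ λ i → x i ^ℝ e i

eval : ∀ {m} → Poly m → Vector ℝ m → ℝ
eval p x = List.foldr (λ t s → evalTerm t x +ℝ s) 0ℝ p

Degree≤ : ∀ {m} → ℕ → Poly m → Set
Degree≤ d = All λ t → sumℕ (proj₂ t) ℕ.≤ d

point : ∀ {m} → Vec Sign m → Vector ℝ m
point x i = signℝ (Vec.lookup x i)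

Approximates : ∀ {m} → ℝ → BoolFn m → Poly m → Set
Approximates ε f p = ∀ x → ∣ signℝ (f x) -ℝ eval p (point x) ∣ℝ ≤ℝ ε

-- "deg_ε f = d", as a relation: computing the least d would require
-- deciding the existence of real coefficients.
IsApproxDegree : ∀ {m} → ℝ → BoolFn m → ℕ → Set
IsApproxDegree {m} ε f d =
  (∃[ p ] Degree≤ d p × Approximates ε f p) ×
  (∀ d′ (p : Poly m) → Degree≤ d′ p → Approximates ε f p → d ℕ.≤ d′)

record ℂ : Set where
  constructor _+i_
  field
    re im : ℝ

open ℂ public

infix 4 _≈ℂ_
infixl 6 _+ℂ_
infixl 7 _*ℂ_

_≈ℂ_ : ℂ → ℂ → Set
z ≈ℂ w = re z ≈ℝ re w × im z ≈ℝ im w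

_+ℂ_ _*ℂ_ : ℂ → ℂ → ℂ
(a +i b) +ℂ (c +i d) = (a +ℝ c) +i (b +ℝ d)
(a +i b) *ℂ (c +i d) = (a *ℝ c -ℝ b *ℝ d) +i (a *ℝ d +ℝ b *ℝ c)

-ℂ_ conj : ℂ → ℂ
-ℂ (a +i b) = (-ℝ a) +i (-ℝ b)
conj (a +i b) = a +i (-ℝ b)

∣_∣² : ℂ → ℝ
∣ a +i b ∣² = a *ℝ a +ℝ b *ℝ b

0ℂ 1ℂ : ℂ
0ℂ = 0ℝ +i 0ℝ
1ℂ = 1ℝ +i 0ℝ

ℂ-rawRing : RawRing 0ℓ 0ℓ
ℂ-rawRing = record
  { _≈_ = _≈ℂ_ ; _+_ = _+ℂ_ ; _*_ = _*ℂ_ ; -_ = -ℂ_ ; 0# = 0ℂ ; 1# = 1ℂ }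

-- Labels (i , b , w) of the basis kets |i,b,w⟩.
Basis : ℕ → ℕ → Set
Basis N W = Fin N × Bool × Fin W

infix 4 _≟ᴮ_
_≟ᴮ_ : ∀ {N W} → DecidableEquality (Basis N W)
_≟ᴮ_ = Product.≡-dec Fin._≟_ (Product.≡-dec Bool._≟_ Fin._≟_)

module BasisSum (R : RawRing 0ℓ 0ℓ) where
  open RawRing R
  open RawSemiringDefs rawSemiring using (sum)

  sumBasis : ∀ {N W} → (Basis N W → Carrier) → Carrier
  sumBasis g = sum λ i →
    sum (λ w → g (i , false , w)) + sum (λ w → g (i , true , w))

open BasisSum ℝ-rawRing public using () renaming (sumBasis to sumBasisℝ)
open BasisSum ℂ-rawRing public using () renaming (sumBasis to sumBasisℂ)

State : ℕ → ℕ → Set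
State N W = Basis N W → ℂ

Operator : ℕ → ℕ → Set
Operator N W = Basis N W → Basis N W → ℂ

ket : ∀ {N W} → Basis N W → State N W
ket t s = if does (s ≟ᴮ t) then 1ℂ else 0ℂ

identity : ∀ {N W} → Operator N W
identity s t = ket t s

infixr 7 _·_ _⊙_

_·_ : ∀ {N W} → Operator N W → State N W → State N W
(U · ψ) s = sumBasisℂ λ t → U s t *ℂ ψ t

_⊙_ : ∀ {N W} → Operator N W → Operator N W → Operator N W
(U ⊙ V) s t = sumBasisℂ λ r → U s r *ℂ V r t

_† : ∀ {N W} → Operator N W → Operator N W
(U †) s t = conj (U t s)

infix 4 _≈ᴼ_
_≈ᴼ_ : ∀ {N W} → Operator N W → Operator N W → Set
U ≈ᴼ V = ∀ s t → U s t ≈ℂ V s t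

_+ᴼ_ : ∀ {N W} → Operator N W → Operator N W → Operator N W
(U +ᴼ V) s t = U s t +ℂ V s t

IsUnitary : ∀ {N W} → Operator N W → Set
IsUnitary U = ((U †) ⊙ U) ≈ᴼ identity × (U ⊙ (U †)) ≈ᴼ identity

normSq : ∀ {N W} → State N W → ℝ
normSq ψ = sumBasisℝ λ s → ∣ ψ s ∣²

bit : Sign → Bool
bit Sign.- = true
bit Sign.+ = false

flip : ∀ {N W} → Vec Sign N → Basis N W → Basis N W
flip x (i , b , w) = i , b xor bit (Vec.lookup x i) , w

-- Since flip x is an involution, the linear operator sending each |s⟩ to
-- |flip x s⟩ has amplitude ψ (flip x s) at s; see oracle-ket.
oracle : ∀ {N W} → Vec Sign N → State N W → State N W
oracle x ψ s = ψ (flip x s)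

private
  xor-cancel : ∀ a b → (a xor b) xor b ≡ a
  xor-cancel true  true  = refl
  xor-cancel true  false = refl
  xor-cancel false true  = refl
  xor-cancel false false = refl

  flip-involutive : ∀ {N W} (x : Vec Sign N) (s : Basis N W) →
    flip x (flip x s) ≡ s
  flip-involutive x (i , b , w) =
    cong (λ b′ → i , b′ , w) (xor-cancel b (bit (Vec.lookup x i)))

oracle-ket : ∀ {N W} (x : Vec Sign N) (t s : Basis N W) →
  oracle x (ket t) s ≡ ket (flip x t) s
oracle-ket x t s = cong (λ b → if b then 1ℂ else 0ℂ)
  (does-⇔ (mk⇔ to from) (flip x s ≟ᴮ t) (s ≟ᴮ flip x t))
  where
  to : flip x s ≡ t → s ≡ flip x t
  to eq = trans (sym (flip-involutive x s)) (cong (flip x) eq)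
  from : s ≡ flip x t → flip x s ≡ t
  from eq = trans (cong (flip x) eq) (flip-involutive x t)

-- The output is the result of a general two-outcome measurement: outcome
-- v has measurement operator measure v and probability ∥ measure v · ψ ∥²
-- on the state ψ.
record QueryAlgorithm (N : ℕ) : Set where
  field
    cost             : ℕ
    workspace        : ℕ
    initial          : State N workspace
    initial-unit     : normSq initial ≈ℝ 1ℝ
    unitary          : Fin (suc cost) → Operator N workspace
    unitary-unitary  : ∀ j → IsUnitary (unitary j)
    measure          : Sign → Operator N workspace
    measure-complete :
      (((measure Sign.+ †) ⊙ measure Sign.+)
        +ᴼ ((measure Sign.- †) ⊙ measure Sign.-)) ≈ᴼ identity

open QueryAlgorithm public

-- U_T O_x U_{T-1} O_x ⋯ U_1 O_x U_0 ψ
run : ∀ {N W} T → (Fin (suc T) → Operator N W) → Vec Sign N →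
      State N W → State N W
run zero    U x ψ = U zero · ψ
run (suc T) U x ψ = U (fromℕ (suc T)) · oracle x (run T (U ∘ inject₁) x ψ)

finalState : ∀ {N} (A : QueryAlgorithm N) → Vec Sign N → State N (workspace A)
finalState A x = run (cost A) (unitary A) x (initial A)

outputProb : ∀ {N} → QueryAlgorithm N → Vec Sign N → Sign → ℝ
outputProb A x v = normSq (measure A v · finalState A x)

ComputesWithProb : ∀ {N} → ℝ → QueryAlgorithm N → BoolFn N → Set
ComputesWithProb q A F = ∀ x → q ≤ℝ outputProb A x (F x)

{-# OPTIONS --safe #-}
module Submission where

-- A real number is a sequence of rationals, so at a fixed late index all the
-- data are rational.  There the acceptance bias of a T-query algorithm is a
-- polynomial P of degree at most 2T that is within 9/20 of ⨂ f.
--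
-- If no polynomial of degree below dᵢ takes values in [1, 5] after
-- multiplication by fᵢ, then Farkas' lemma gives measures λᵢ and κᵢ that agree
-- on polynomials of degree below dᵢ, with ‖λᵢ‖ ≤ 1, ‖κᵢ‖ ≤ 1/5 and λᵢ(fᵢ) = 1.
-- Two odd cubics squeeze [1, 5] into [4/5, 6/5], so dᵢ may be taken to be at
-- least deg_{1/5}(fᵢ) / 9.
--
-- Now ⊗λᵢ maps ⨂ f to 1, hence P to at least 11/20.  On the other hand, expand
-- λᵢ = κᵢ + (λᵢ − κᵢ) one block at a time, in decreasing order of dᵢ, and stop
-- as soon as more factors κᵢ than differences have been chosen.  The stopped
-- terms contribute a geometric series that is at most a third of ‖P‖, and an
-- unstopped term annihilates every polynomial of degree below Σ dᵢ / 2.  So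
-- 2T < Σ dᵢ / 2 is impossible.

open import Defs
open import Algebra.Bundles using (CommutativeMonoid; CommutativeRing)
open import Algebra.Bundles.Raw using (RawRing)
import Algebra.Definitions.RawSemiring as RawSemiringDefs
import Algebra.Properties.CommutativeMonoid.Sum as MonoidSum
import Algebra.Properties.CommutativeSemigroup as CommutativeSemigroupProperties
import Algebra.Properties.Semiring.Exp as SemiringExp
import Algebra.Properties.Semiring.Sum as SemiringSum
open import Data.Bool.Base using (Bool; true; false; if_then_else_; not; _xor_)
open import Data.Fin.Base
  using (Fin; zero; suc; punchIn; fromℕ; inject₁; combine; remQuot; _↑ˡ_; _↑ʳ_)
import Data.Fin.Properties as Fin
import Data.Integer.Base as ℤ
import Data.Integer.Properties as ℤ
open import Data.List.Base as List
  using (List; []; _∷_; _++_; map; cartesianProduct; cartesianProductWith)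
open import Data.List.Membership.Propositional using (_∈_)
open import Data.List.Membership.Propositional.Properties
  using (∈-cartesianProduct⁺; ∈-cartesianProductWith⁺)
open import Data.List.Relation.Unary.All as All using (All; []; _∷_)
open import Data.List.Relation.Unary.All.Properties using (++⁻ˡ; ++⁻ʳ; map⁻)
open import Data.List.Relation.Unary.Any as Any using (Any; here; there)
import Data.List.Relation.Unary.Any.Properties as Any
open import Data.Maybe.Base using (Maybe; just; nothing)
open import Data.Nat.Base as ℕ using (ℕ; zero; suc)
import Data.Nat.DivMod as ℕ
import Data.Nat.Properties as ℕ
import Data.Nat.Tactic.RingSolver as ℕSolver
open import Data.Product.Base
  using (∃-syntax; Σ-syntax; _×_; _,_; proj₁; proj₂; uncurry)
import Data.Rational.Unnormalised.Base as ℚᵘ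
import Data.Rational.Unnormalised.Properties as ℚᵘ
open import Data.Sign.Base as Sign using (Sign)
open import Data.Sum.Base using (_⊎_; inj₁; inj₂)
open import Data.Unit.Base using (⊤; tt)
open import Data.Vec.Base as Vec using (Vec; []; _∷_; lookup)
open import Data.Vec.Functional using (insertAt; removeAt)
open import Data.Vec.Functional.Properties using (insertAt-lookup; insertAt-punchIn)
import Data.Vec.Properties as Vec
open import Function.Base using (_∘_)
open import Level using (0ℓ)
open import Relation.Binary.Definitions using (tri<; tri≈; tri>)
open import Relation.Binary.PropositionalEquality
  using (_≡_; _≢_; refl; sym; trans; cong; cong₂; subst; subst₂; module ≡-Reasoning)
import Relation.Binary.Reasoning.Setoid as SetoidReasoning
open import Relation.Nullary.Decidable
  using (yes; no; dec⇒maybe; dec-true; dec-false; from-yes; from-no)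
open import Relation.Nullary.Negation using (contradiction)
open import Tactic.RingSolver using (solve-∀)
import Tactic.RingSolver.Core.AlmostCommutativeRing as ACR

-- Finite sums and adjoints

-- Order and equality of real numbers are limit statements, whereas elimination has to decide the
-- signs of its pivots. At one fixed index sums and products are computed termwise in ℚ, so degree
-- bounds and the nonnegativity of squares hold exactly there. Only two facts hold merely in the
-- limit: that the outcome probabilities add up to 1, and that the correct one is at least 4/5. Each
-- costs a tolerance of 1/100.
--
-- The expansion has to be stopped because its full absolute weight can grow like (1 + 2β)ⁿ when
-- ‖κᵢ‖ ≤ β; a stopped term keeps the untouched λᵢ, of mass at most 1. A factor κ weighs β and a
-- difference at most 1 + β, so the total weight ρ of all stopped terms is governed by first-step
-- analysis of a walk: ρ = β + (1 + β)ρ². Real roots exist only for β ≤ (√2 - 1)/2 ≈ 0.207. The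
-- endpoints of the range of fᵢ times the polynomial must therefore have ratio at least about 4.83,
-- and the ratio 5 gives the smaller root ρ = 1/3.

module SumCombine (M : CommutativeMonoid 0ℓ 0ℓ) where
  open CommutativeMonoid M renaming (trans to ≈-trans; sym to ≈-sym; refl to ≈-refl)
  open MonoidSum M using (sum)

  sum-↑ : ∀ m {n} (t : Fin (m ℕ.+ n) → Carrier) → sum t ≈ sum (λ i → t (i ↑ˡ n)) ∙ sum (λ j → t (m ↑ʳ j))
  sum-↑ zero    t = ≈-sym (identityˡ _)
  sum-↑ (suc m) t = ≈-trans (∙-congˡ (sum-↑ m (t ∘ suc))) (≈-sym (assoc _ _ _))

  sum-combine : ∀ n m (t : Fin (n ℕ.* m) → Carrier) →
    sum t ≈ sum {n} (λ i → sum {m} (λ j → t (combine i j)))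
  sum-combine zero    m t = ≈-refl
  sum-combine (suc n) m t = ≈-trans (sum-↑ m t) (∙-congˡ (sum-combine n m (λ k → t (m ↑ʳ k))))

module BasisSumProperties (R : CommutativeRing 0ℓ 0ℓ) where
  open CommutativeRing R hiding (zero)
    renaming (Carrier to C; refl to ≈-refl; sym to ≈-sym; trans to ≈-trans)
  open SemiringSum semiring using (sum; sum-cong-≋; sum-remove; sum-replicate-zero)
    renaming (∑-distrib-+ to sum-distrib-+)
  open BasisSum rawRing public

  module _ {N W : ℕ} where

    sumBasis-cong : {g h : Basis N W → C} → (∀ s → g s ≈ h s) → sumBasis g ≈ sumBasis h
    sumBasis-cong g≈h = sum-cong-≋ λ i → +-cong
      (sum-cong-≋ λ w → g≈h (i , false , w)) (sum-cong-≋ λ w → g≈h (i , true , w))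

    -- One interchange principle for several laws: with `A = ⊤` the functional `L` is a scalar map
    -- such as multiplication by a constant or `star`, and with `L` a sum over the basis it becomes
    -- the exchange of two sums.
    module Additive {A : Set} (L : (A → C) → C)
      (L-+ : ∀ g h → L (λ a → g a + h a) ≈ L g + L h)
      (L-0 : L (λ _ → 0#) ≈ 0#) where

      L-sum : ∀ {n} (h : Fin n → A → C) → L (λ a → sum λ i → h i a) ≈ sum λ i → L (h i)
      L-sum {zero}  h = L-0
      L-sum {suc n} h = ≈-trans (L-+ (h zero) _) (+-congˡ (L-sum (h ∘ suc)))

      L-sumBasis : (h : Basis N W → A → C) → L (λ a → sumBasis λ s → h s a) ≈ sumBasis λ s → L (h s)
      L-sumBasis h = ≈-trans (L-sum {N} _) (sum-cong-≋ {N} λ i → ≈-trans (L-+ _ _)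
        (+-cong (L-sum λ w → h (i , false , w)) (L-sum λ w → h (i , true , w))))

    sumBasis-+ : (g h : Basis N W → C) → sumBasis (λ s → g s + h s) ≈ sumBasis g + sumBasis h
    sumBasis-+ g h = ≈-trans
      (sum-cong-≋ {N} λ i → ≈-trans (+-cong (sum-distrib-+ (gᶠ i) (hᶠ i)) (sum-distrib-+ (gᵗ i) (hᵗ i)))
        (interchange (sum (gᶠ i)) (sum (hᶠ i)) (sum (gᵗ i)) (sum (hᵗ i))))
      (sum-distrib-+ (λ i → sum (gᶠ i) + sum (gᵗ i)) (λ i → sum (hᶠ i) + sum (hᵗ i)))
      where
      open CommutativeSemigroupProperties +-commutativeSemigroup using (interchange)
      gᶠ gᵗ hᶠ hᵗ : Fin N → Fin W → C
      gᶠ i w = g (i , false , w)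
      gᵗ i w = g (i , true , w)
      hᶠ i w = h (i , false , w)
      hᵗ i w = h (i , true , w)

    sum-0 : ∀ {n} {g : Fin n → C} → (∀ i → g i ≈ 0#) → sum g ≈ 0#
    sum-0 {n} g≈0 = ≈-trans (sum-cong-≋ g≈0) (sum-replicate-zero n)

    sumBasis-0 : {g : Basis N W → C} → (∀ s → g s ≈ 0#) → sumBasis g ≈ 0#
    sumBasis-0 g≈0 = sum-0 λ i → ≈-trans
      (+-cong (sum-0 λ w → g≈0 (i , false , w)) (sum-0 λ w → g≈0 (i , true , w))) (+-identityˡ 0#)

    sum-single : ∀ {n} (g : Fin n → C) i → (∀ j → j ≢ i → g j ≈ 0#) → sum g ≈ g i
    sum-single {suc n} g i others = ≈-trans (sum-remove {i = i} g)
      (≈-trans (+-congˡ (sum-0 λ j → others (punchIn i j) (Fin.punchInᵢ≢i i j))) (+-identityʳ (g i)))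

    sumBasis-single : (g : Basis N W → C) (s : Basis N W) → (∀ t → t ≢ s → g t ≈ 0#) → sumBasis g ≈ g s
    sumBasis-single g (i , b , w) others = ≈-trans
      (sum-single (λ j → sum (gᵇ j false) + sum (gᵇ j true)) i λ j j≢i → ≈-trans
        (+-cong (sum-0 {g = gᵇ j false} λ v → others (j , false , v) (j≢i ∘ cong proj₁))
                (sum-0 {g = gᵇ j true} λ v → others (j , true , v) (j≢i ∘ cong proj₁)))
        (+-identityˡ 0#))
      (pick b others)
      where
      gᵇ : Fin N → Bool → Fin W → C
      gᵇ j b v = g (j , b , v)
      pick : ∀ b → (∀ t → t ≢ (i , b , w) → g t ≈ 0#) → sum (gᵇ i false) + sum (gᵇ i true) ≈ g (i , b , w)
      pick false others = ≈-trans
        (+-cong (sum-single (gᵇ i false) w λ v v≢w → others (i , false , v) (v≢w ∘ cong (proj₂ ∘ proj₂)))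
                (sum-0 {g = gᵇ i true} λ v → others (i , true , v) λ ()))
        (+-identityʳ (g (i , false , w)))
      pick true others = ≈-trans
        (+-cong (sum-0 {g = gᵇ i false} λ v → others (i , false , v) λ ())
                (sum-single (gᵇ i true) w λ v v≢w → others (i , true , v) (v≢w ∘ cong (proj₂ ∘ proj₂))))
        (+-identityˡ (g (i , true , w)))

    *-distribˡ-sumBasis : ∀ c (g : Basis N W → C) → c * sumBasis g ≈ sumBasis (λ s → c * g s)
    *-distribˡ-sumBasis c g = Additive.L-sumBasis {A = ⊤} (λ h → c * h tt)
      (λ g h → distribˡ c (g tt) (h tt)) (zeroʳ c) (λ s _ → g s)

    *-distribʳ-sumBasis : ∀ c (g : Basis N W → C) → sumBasis g * c ≈ sumBasis (λ s → g s * c)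
    *-distribʳ-sumBasis c g = Additive.L-sumBasis {A = ⊤} (λ h → h tt * c)
      (λ g h → distribʳ c (g tt) (h tt)) (zeroˡ c) (λ s _ → g s)

    sumBasis-comm : (h : Basis N W → Basis N W → C) →
      sumBasis (λ s → sumBasis (h s)) ≈ sumBasis (λ t → sumBasis (λ s → h s t))
    sumBasis-comm h = Additive.L-sumBasis sumBasis sumBasis-+ (sumBasis-0 λ _ → ≈-refl) λ t s → h s t

  module Adjoint (star : C → C)
    (star-+ : ∀ x y → star (x + y) ≈ star x + star y)
    (star-* : ∀ x y → star (x * y) ≈ star x * star y)
    (star-0 : star 0# ≈ 0#) {N W : ℕ} where

    apply : (Basis N W → Basis N W → C) → (Basis N W → C) → Basis N W → C
    apply U ψ s = sumBasis λ t → U s t * ψ t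

    -- This is U†U. Preservation of the norm and completeness of a measurement are both read off
    -- from it.
    gram : (Basis N W → Basis N W → C) → Basis N W → Basis N W → C
    gram U s t = sumBasis λ r → star (U r s) * U r t

    inner : (Basis N W → C) → (Basis N W → C) → C
    inner φ ψ = sumBasis λ s → star (φ s) * ψ s

    star-sumBasis : (g : Basis N W → C) → star (sumBasis g) ≈ sumBasis (star ∘ g)
    star-sumBasis g = Additive.L-sumBasis {A = ⊤} (λ h → star (h tt))
      (λ g h → star-+ (g tt) (h tt)) star-0 (λ s _ → g s)

    -- The adjoint identity ⟨Uφ, ψ⟩ = ⟨φ, U†ψ⟩, with U†ψ written out as a sum.
    inner-apply : ∀ U φ ψ → inner (apply U φ) ψ ≈ inner φ (λ t → sumBasis λ s → star (U s t) * ψ s)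
    inner-apply U φ ψ = begin
      sumBasis (λ s → star (apply U φ s) * ψ s)
        ≈⟨ sumBasis-cong (λ s → ≈-trans (*-congʳ (star-sumBasis λ t → U s t * φ t))
             (≈-trans (*-distribʳ-sumBasis (ψ s) λ t → star (U s t * φ t)) (sumBasis-cong λ t → entry s t))) ⟩
      sumBasis (λ s → sumBasis λ t → star (φ t) * (star (U s t) * ψ s))
        ≈⟨ sumBasis-comm (λ s t → star (φ t) * (star (U s t) * ψ s)) ⟩
      sumBasis (λ t → sumBasis λ s → star (φ t) * (star (U s t) * ψ s))
        ≈⟨ sumBasis-cong (λ t → *-distribˡ-sumBasis (star (φ t)) λ s → star (U s t) * ψ s) ⟨
      inner φ (λ t → sumBasis λ s → star (U s t) * ψ s) ∎
      where
      open SetoidReasoning setoid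
      entry : ∀ s t → star (U s t * φ t) * ψ s ≈ star (φ t) * (star (U s t) * ψ s)
      entry s t = ≈-trans (*-congʳ (≈-trans (star-* (U s t) (φ t)) (*-comm (star (U s t)) (star (φ t)))))
        (*-assoc (star (φ t)) (star (U s t)) (ψ s))

    gram-apply : ∀ U ψ t → sumBasis (λ s → star (U s t) * apply U ψ s) ≈ apply (gram U) ψ t
    gram-apply U ψ t = begin
      sumBasis (λ s → star (U s t) * apply U ψ s)
        ≈⟨ sumBasis-cong (λ s → ≈-trans (*-distribˡ-sumBasis (star (U s t)) λ r → U s r * ψ r)
             (sumBasis-cong λ r → ≈-sym (*-assoc (star (U s t)) (U s r) (ψ r)))) ⟩
      sumBasis (λ s → sumBasis λ r → star (U s t) * U s r * ψ r)
        ≈⟨ sumBasis-comm (λ s r → star (U s t) * U s r * ψ r) ⟩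
      sumBasis (λ r → sumBasis λ s → star (U s t) * U s r * ψ r)
        ≈⟨ sumBasis-cong (λ r → *-distribʳ-sumBasis (ψ r) λ s → star (U s t) * U s r) ⟨
      apply (gram U) ψ t ∎
      where open SetoidReasoning setoid

    inner-cong : ∀ φ {ψ ψ′} → (∀ s → ψ s ≈ ψ′ s) → inner φ ψ ≈ inner φ ψ′
    inner-cong φ ψ≈ψ′ = sumBasis-cong λ s → *-congˡ {star (φ s)} (ψ≈ψ′ s)

    inner-gram : ∀ U ψ → inner (apply U ψ) (apply U ψ) ≈ inner ψ (apply (gram U) ψ)
    inner-gram U ψ = ≈-trans (inner-apply U ψ (apply U ψ)) (inner-cong ψ (gram-apply U ψ))

    apply-identity : ∀ (I : Basis N W → Basis N W → C) →
      (∀ s → I s s ≈ 1#) → (∀ s t → t ≢ s → I s t ≈ 0#) → ∀ ψ s → apply I ψ s ≈ ψ s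
    apply-identity I diag off ψ s = ≈-trans
      (sumBasis-single (λ t → I s t * ψ t) s λ t t≢s → ≈-trans (*-congʳ (off s t t≢s)) (zeroˡ (ψ t)))
      (≈-trans (*-congʳ (diag s)) (*-identityˡ (ψ s)))

    apply-cong : ∀ {U V} → (∀ s t → U s t ≈ V s t) → ∀ ψ s → apply U ψ s ≈ apply V ψ s
    apply-cong U≈V ψ s = sumBasis-cong λ t → *-congʳ {ψ t} (U≈V s t)

    apply-+ : ∀ U V ψ s → apply U ψ s + apply V ψ s ≈ apply (λ s t → U s t + V s t) ψ s
    apply-+ U V ψ s = ≈-trans (≈-sym (sumBasis-+ (λ t → U s t * ψ t) (λ t → V s t * ψ t)))
      (sumBasis-cong λ t → ≈-sym (distribʳ (ψ t) (U s t) (V s t)))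

    inner-+ : ∀ φ ψ ψ′ → inner φ ψ + inner φ ψ′ ≈ inner φ (λ s → ψ s + ψ′ s)
    inner-+ φ ψ ψ′ = ≈-trans (≈-sym (sumBasis-+ (λ s → star (φ s) * ψ s) (λ s → star (φ s) * ψ′ s)))
      (sumBasis-cong λ s → ≈-sym (distribˡ (star (φ s)) (ψ s) (ψ′ s)))

    isometry : ∀ {U I} → (∀ s t → gram U s t ≈ I s t) →
      (∀ s → I s s ≈ 1#) → (∀ s t → t ≢ s → I s t ≈ 0#) →
      ∀ ψ → inner (apply U ψ) (apply U ψ) ≈ inner ψ ψ
    isometry {U} {I} gram≈ diag off ψ = ≈-trans (inner-gram U ψ)
      (inner-cong ψ λ s → ≈-trans (apply-cong {V = I} gram≈ ψ s) (apply-identity I diag off ψ s))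

    complete : ∀ {U V I} → (∀ s t → gram U s t + gram V s t ≈ I s t) →
      (∀ s → I s s ≈ 1#) → (∀ s t → t ≢ s → I s t ≈ 0#) →
      ∀ ψ → inner (apply U ψ) (apply U ψ) + inner (apply V ψ) (apply V ψ) ≈ inner ψ ψ
    complete {U} {V} {I} gram≈ diag off ψ = ≈-trans (+-cong (inner-gram U ψ) (inner-gram V ψ))
      (≈-trans (inner-+ ψ (apply (gram U) ψ) (apply (gram V) ψ)) (inner-cong ψ λ s →
        ≈-trans (apply-+ (gram U) (gram V) ψ s)
          (≈-trans (apply-cong {V = I} gram≈ ψ s) (apply-identity I diag off ψ s))))

-- Inequalities and finite sums over ℚ

open import Data.Rational.Base as ℚ
  using (ℚ; 0ℚ; 1ℚ; _+_; _*_; -_; _-_; _≤_; _<_; ∣_∣; positive; nonNegative)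
open import Data.Rational.Properties as ℚ

open MonoidSum *-1-commutativeMonoid using ()
  renaming (sum to ∏; sum-remove to ∏-remove; sum-cong-≗ to ∏-cong;
            sum-replicate-zero to ∏-one; ∑-distrib-+ to ∏-distrib-*)
open MonoidSum ℕ.+-0-commutativeMonoid using ()
  renaming (sum-remove to sumℕ-remove; sum-replicate-zero to sumℕ-zero;
            ∑-distrib-+ to sumℕ-distrib-+)
open SemiringExp (CommutativeRing.semiring +-*-commutativeRing) using (_^_; ^-homo-*)

private variable
  A B X τ : Set

ℚ-ring : ACR.AlmostCommutativeRing 0ℓ 0ℓ
ℚ-ring = ACR.fromCommutativeRing +-*-commutativeRing λ q → dec⇒maybe (0ℚ ℚ.≟ q)

-- Most inequalities below exhibit their slack `e` as a visibly nonnegative expression, which leaves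
-- a ring identity for the solver.
≤-by : ∀ {a b} e → 0ℚ ≤ e → b ≡ a + e → a ≤ b
≤-by {a} {b} e 0≤e eq = begin
  a       ≡⟨ +-identityʳ a ⟨
  a + 0ℚ  ≤⟨ +-monoʳ-≤ a 0≤e ⟩
  a + e   ≡⟨ eq ⟨
  b       ∎
  where open ≤-Reasoning

0≤-diff : ∀ {a b} → a ≤ b → 0ℚ ≤ b - a
0≤-diff {a} {b} a≤b = subst (_≤ b - a) (+-inverseʳ a) (+-monoˡ-≤ (- a) a≤b)

0≤+ : ∀ {a b} → 0ℚ ≤ a → 0ℚ ≤ b → 0ℚ ≤ a + b
0≤+ = +-mono-≤

0≤* : ∀ {a b} → 0ℚ ≤ a → 0ℚ ≤ b → 0ℚ ≤ a * b
0≤* {a} {b} 0≤a 0≤b = nonNegative⁻¹ (a * b)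
  {{nonNeg*nonNeg⇒nonNeg a {{nonNegative 0≤a}} b {{nonNegative 0≤b}}}}

*-monoʳ : ∀ {a b c} → 0ℚ ≤ c → a ≤ b → c * a ≤ c * b
*-monoʳ {c = c} 0≤c = *-monoˡ-≤-nonNeg c {{nonNegative 0≤c}}

*-monoˡ : ∀ {a b c} → 0ℚ ≤ c → a ≤ b → a * c ≤ b * c
*-monoˡ {c = c} 0≤c = *-monoʳ-≤-nonNeg c {{nonNegative 0≤c}}

∑ : List A → (A → ℚ) → ℚ
∑ []       f = 0ℚ
∑ (a ∷ as) f = f a + ∑ as f

∑-cong : ∀ (as : List A) {f g : A → ℚ} → (∀ a → f a ≡ g a) → ∑ as f ≡ ∑ as g
∑-cong []       f≗g = refl
∑-cong (a ∷ as) f≗g = cong₂ _+_ (f≗g a) (∑-cong as f≗g)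

∑-zero : ∀ (as : List A) {f : A → ℚ} → (∀ a → f a ≡ 0ℚ) → ∑ as f ≡ 0ℚ
∑-zero []       f≗0 = refl
∑-zero (a ∷ as) f≗0 = cong₂ _+_ (f≗0 a) (∑-zero as f≗0)

∑-distrib-+ : ∀ (as : List A) (f g : A → ℚ) → ∑ as (λ a → f a + g a) ≡ ∑ as f + ∑ as g
∑-distrib-+ []       f g = refl
∑-distrib-+ (a ∷ as) f g =
  trans (cong (f a + g a +_) (∑-distrib-+ as f g)) (lemma (f a) (g a) (∑ as f) (∑ as g))
  where
  lemma : ∀ a b c d → a + b + (c + d) ≡ a + c + (b + d)
  lemma = solve-∀ ℚ-ring

∑-distribˡ-* : ∀ (as : List A) q (f : A → ℚ) → q * ∑ as f ≡ ∑ as (λ a → q * f a)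
∑-distribˡ-* []       q f = *-zeroʳ q
∑-distribˡ-* (a ∷ as) q f =
  trans (*-distribˡ-+ q (f a) (∑ as f)) (cong (q * f a +_) (∑-distribˡ-* as q f))

∑-distribʳ-* : ∀ (as : List A) q (f : A → ℚ) → ∑ as f * q ≡ ∑ as (λ a → f a * q)
∑-distribʳ-* []       q f = *-zeroˡ q
∑-distribʳ-* (a ∷ as) q f =
  trans (*-distribʳ-+ q (f a) (∑ as f)) (cong (f a * q +_) (∑-distribʳ-* as q f))

∑-comm : ∀ (as : List A) (bs : List B) (f : A → B → ℚ) →
  ∑ as (λ a → ∑ bs (f a)) ≡ ∑ bs (λ b → ∑ as (λ a → f a b))
∑-comm []       bs f = sym (∑-zero bs λ _ → refl)
∑-comm (a ∷ as) bs f =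
  trans (cong (∑ bs (f a) +_) (∑-comm as bs f)) (sym (∑-distrib-+ bs (f a) _))

∑-++ : ∀ (as bs : List A) (f : A → ℚ) → ∑ (as ++ bs) f ≡ ∑ as f + ∑ bs f
∑-++ []       bs f = sym (+-identityˡ _)
∑-++ (a ∷ as) bs f =
  trans (cong (f a +_) (∑-++ as bs f)) (sym (+-assoc (f a) (∑ as f) (∑ bs f)))

∑-map : ∀ (as : List A) (h : A → B) (f : B → ℚ) → ∑ (map h as) f ≡ ∑ as (f ∘ h)
∑-map []       h f = refl
∑-map (a ∷ as) h f = cong (f (h a) +_) (∑-map as h f)

∑-mono : ∀ (as : List A) {f g : A → ℚ} → (∀ a → f a ≤ g a) → ∑ as f ≤ ∑ as g
∑-mono []       f≤g = ≤-refl
∑-mono (a ∷ as) f≤g = +-mono-≤ (f≤g a) (∑-mono as f≤g)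

∑-abs : ∀ (as : List A) (f : A → ℚ) → ∣ ∑ as f ∣ ≤ ∑ as (λ a → ∣ f a ∣)
∑-abs []       f = ≤-refl
∑-abs (a ∷ as) f = ≤-trans (∣p+q∣≤∣p∣+∣q∣ (f a) (∑ as f))
  (+-monoʳ-≤ ∣ f a ∣ (∑-abs as f))

∑-nonNeg : ∀ (as : List A) {f : A → ℚ} → (∀ a → 0ℚ ≤ f a) → 0ℚ ≤ ∑ as f
∑-nonNeg []       0≤f = ≤-refl
∑-nonNeg (a ∷ as) 0≤f = 0≤+ (0≤f a) (∑-nonNeg as 0≤f)

-- Farkas' lemma

ℚ≥0 : Set
ℚ≥0 = Σ[ q ∈ ℚ ] 0ℚ ≤ q

dot : ∀ {k} → (Fin k → ℚ) → (Fin k → ℚ) → ℚ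
dot {zero}  a c = 0ℚ
dot {suc k} a c = a zero * c zero + dot (a ∘ suc) (c ∘ suc)

dot-linear : ∀ {k} p q (a b c : Fin k → ℚ) →
  dot (λ j → p * a j + q * b j) c ≡ p * dot a c + q * dot b c
dot-linear {zero}  p q a b c = sym (cong₂ _+_ (*-zeroʳ p) (*-zeroʳ q))
dot-linear {suc k} p q a b c =
  trans (cong ((p * a zero + q * b zero) * c zero +_) (dot-linear p q (a ∘ suc) (b ∘ suc) (c ∘ suc)))
    (lemma p q (a zero) (b zero) (c zero) (dot (a ∘ suc) (c ∘ suc)) (dot (b ∘ suc) (c ∘ suc)))
  where
  lemma : ∀ p q a b c s t →
    (p * a + q * b) * c + (p * s + q * t) ≡ p * (a * c + s) + q * (b * c + t)
  lemma = solve-∀ ℚ-ring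

Solution : ∀ {k} {R : Set} → List R → (R → Fin k → ℚ) → (R → ℚ) → Set
Solution {k} rows a b = Σ[ c ∈ (Fin k → ℚ) ] All (λ r → b r ≤ dot (a r) c) rows

-- A nonnegative combination of rows in which every unknown cancels and the right-hand side stays
-- positive. A row may occur several times, so certificates can be pulled back through an
-- elimination by mere concatenation.
Certificate : ∀ {k} {R : Set} → (R → Fin k → ℚ) → (R → ℚ) → Set
Certificate {k} {R} a b = Σ[ ws ∈ List (ℚ≥0 × R) ]
  (∀ j → ∑ ws (λ (y , r) → proj₁ y * a r j) ≡ 0ℚ) ×
  0ℚ < ∑ ws (λ (y , r) → proj₁ y * b r)

below : ∀ (bs : List B) (u : B → ℚ) → ∃[ c ] All (λ b → c ≤ u b) bs
below []       u = 0ℚ , []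
below (b ∷ bs) u with below bs u
... | c , c≤u = u b ℚ.⊓ c , p⊓q≤p (u b) c ∷ All.map (≤-trans (p⊓q≤q (u b) c)) c≤u

-- Helly's theorem on the line: pairwise compatible bounds have a common point. The witness is the
-- maximum of the lower bounds and of one value below all upper bounds, which also covers the
-- absence of lower bounds.
between : ∀ (as : List A) (bs : List B) (l : A → ℚ) (u : B → ℚ) →
  All (λ a → All (λ b → l a ≤ u b) bs) as →
  ∃[ c ] All (λ a → l a ≤ c) as × All (λ b → c ≤ u b) bs
between []       bs l u [] with below bs u
... | c , c≤u = c , [] , c≤u
between (a ∷ as) bs l u (la≤u ∷ l≤u) with between as bs l u l≤u
... | c , l≤c , c≤u = l a ℚ.⊔ c ,
  p≤p⊔q (l a) c ∷ All.map (λ x≤c → ≤-trans x≤c (p≤q⊔p (l a) c)) l≤c ,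
  All.zipWith (λ (x≤ , c≤) → ⊔-lub x≤ c≤) (la≤u , c≤u)

module Signs {R : Set} (v : R → ℚ) where
  Zero⁰ Pos⁺ Neg⁻ : Set
  Zero⁰ = Σ[ r ∈ R ] v r ≡ 0ℚ
  Pos⁺  = Σ[ r ∈ R ] 0ℚ < v r
  Neg⁻  = Σ[ r ∈ R ] v r < 0ℚ

  splitBySign : (rows : List R) →
    Σ[ zs ∈ List Zero⁰ ] Σ[ ps ∈ List Pos⁺ ] Σ[ ns ∈ List Neg⁻ ]
    (∀ {Q : R → Set} → All (Q ∘ proj₁) zs → All (Q ∘ proj₁) ps → All (Q ∘ proj₁) ns → All Q rows)
  splitBySign [] = [] , [] , [] , λ _ _ _ → []
  splitBySign (r ∷ rows) with splitBySign rows | <-cmp (v r) 0ℚ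
  ... | zs , ps , ns , merge | tri< v<0 _ _ =
    zs , ps , (r , v<0) ∷ ns , λ { az ap (q ∷ an) → q ∷ merge az ap an }
  ... | zs , ps , ns , merge | tri≈ _ v≡0 _ =
    (r , v≡0) ∷ zs , ps , ns , λ { (q ∷ az) ap an → q ∷ merge az ap an }
  ... | zs , ps , ns , merge | tri> _ _ 0<v =
    zs , (r , 0<v) ∷ ps , ns , λ { az (q ∷ ap) an → q ∷ merge az ap an }

-- Fourier–Motzkin elimination of the first unknown.
farkas : ∀ k {R : Set} (rows : List R) (a : R → Fin k → ℚ) (b : R → ℚ) →
  Solution rows a b ⊎ Certificate a b
farkas zero [] a b = inj₁ ((λ ()) , [])
farkas zero (r ∷ rows) a b with b r ℚ.≤? 0ℚ | farkas zero rows a b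
... | yes b≤0 | inj₁ (c , sat)  = inj₁ (c , b≤0 ∷ sat)
... | yes b≤0 | inj₂ cert = inj₂ cert
-- Without unknowns a row reads `b r ≤ 0`, so a violated row with weight 1 is a certificate by
-- itself.
... | no  b≰0 | _ = inj₂ (((1ℚ , from-yes (0ℚ ℚ.≤? 1ℚ)) , r) ∷ [] , (λ ()) ,
  subst (0ℚ <_) (sym (trans (+-identityʳ _) (*-identityˡ (b r)))) (≰⇒> b≰0))
farkas (suc k) {R} rows a b = conclude (farkas k rows′ a′ b′)
  where
  open Signs (λ r → a r zero)
  zs = proj₁ (splitBySign rows)
  ps = proj₁ (proj₂ (splitBySign rows))
  ns = proj₁ (proj₂ (proj₂ (splitBySign rows)))
  merge = proj₂ (proj₂ (proj₂ (splitBySign rows)))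

  R′ : Set
  R′ = Zero⁰ ⊎ (Pos⁺ × Neg⁻)

  rows′ : List R′
  rows′ = map inj₁ zs ++ map inj₂ (cartesianProduct ps ns)

  -- Both multipliers are positive and together cancel the first unknown. An arbitrary `h` is
  -- allowed because coefficients and right-hand sides are combined alike.
  eliminate : (R → ℚ) → R′ → ℚ
  eliminate h (inj₁ (r , _)) = h r
  eliminate h (inj₂ ((p , _) , (n , _))) = (- a n zero) * h p + a p zero * h n

  a′ : R′ → Fin k → ℚ
  a′ r j = eliminate (λ s → a s (suc j)) r
  b′ : R′ → ℚ
  b′ = eliminate b

  expand : ℚ≥0 × R′ → List (ℚ≥0 × R)
  expand (y , inj₁ (r , _)) = (y , r) ∷ []
  expand ((y , 0≤y) , inj₂ ((p , 0<p) , (n , n<0))) =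
    ((y * (- a n zero) , 0≤* 0≤y (<⇒≤ (neg-antimono-< n<0))) , p) ∷
    ((y * a p zero , 0≤* 0≤y (<⇒≤ 0<p)) , n) ∷ []

  ∑-expand : ∀ (h : R → ℚ) ws →
    ∑ (List.concatMap expand ws) (λ (y , r) → proj₁ y * h r) ≡
    ∑ ws (λ (y , r) → proj₁ y * eliminate h r)
  ∑-expand h [] = refl
  ∑-expand h (w ∷ ws) = trans (∑-++ (expand w) (List.concatMap expand ws) _)
    (cong₂ _+_ (one w) (∑-expand h ws))
    where
    lemma : ∀ y n p s t → y * n * s + (y * p * t + 0ℚ) ≡ y * (n * s + p * t)
    lemma = solve-∀ ℚ-ring
    one : ∀ w → ∑ (expand w) (λ (y , r) → proj₁ y * h r) ≡ proj₁ (proj₁ w) * eliminate h (proj₂ w)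
    one (y , inj₁ _) = +-identityʳ _
    one ((y , _) , inj₂ ((p , _) , (n , _))) = lemma y (- a n zero) (a p zero) (h p) (h n)

  eliminated : ∀ r → eliminate (λ s → a s zero) r ≡ 0ℚ
  eliminated (inj₁ (_ , eq)) = eq
  eliminated (inj₂ ((p , _) , (n , _))) = lemma (a n zero) (a p zero)
    where
    lemma : ∀ s t → (- s) * t + t * s ≡ 0ℚ
    lemma = solve-∀ ℚ-ring

  back-substitute : Solution rows′ a′ b′ → Solution rows a b
  back-substitute (c , sat) = extend (between ps ns lower upper
      (All.tabulate λ p∈ → All.tabulate λ n∈ → order p∈ n∈))
    where
    rest : R → ℚ
    rest r = b r - dot (a r ∘ suc) c
    inv : ∀ q → 0ℚ < q → ℚ
    inv q 0<q = ℚ.1/_ q {{pos⇒nonZero q {{positive 0<q}}}}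
    inv-pos : ∀ q 0<q → 0ℚ ≤ inv q 0<q
    inv-pos q 0<q = <⇒≤ (positive⁻¹ (inv q 0<q) {{1/pos⇒pos q {{positive 0<q}}}})
    inv-mul : ∀ q 0<q → q * inv q 0<q ≡ 1ℚ
    inv-mul q 0<q = *-inverseʳ q {{pos⇒nonZero q {{positive 0<q}}}}
    lower : Pos⁺ → ℚ
    lower (p , 0<p) = inv (a p zero) 0<p * rest p
    upper : Neg⁻ → ℚ
    upper (n , n<0) = inv (- a n zero) (neg-antimono-< n<0) * (- rest n)

    -- The slack between the two bounds is that of the derived row of `p` and `n`, divided by both
    -- pivots.
    order : ∀ {p n} → p ∈ ps → n ∈ ns → lower p ≤ upper n
    order {p , 0<p} {n , n<0} p∈ n∈ = ≤-by (α * γ * gap)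
      (0≤* (0≤* (inv-pos Q 0<p) (inv-pos N 0<N)) (0≤-diff pair≤)) (sym (begin
        α * (bp - dp) + α * γ * gap
          ≡⟨ expand-gap α γ Q N bp dp bn dn ⟩
        α * (bp - dp) - (N * γ) * (α * (bp - dp)) - (Q * α) * (γ * (bn - dn))
          ≡⟨ cong₂ (λ s t → α * (bp - dp) - s * (α * (bp - dp)) - t * (γ * (bn - dn)))
               (inv-mul N 0<N) (inv-mul Q 0<p) ⟩
        α * (bp - dp) - 1ℚ * (α * (bp - dp)) - 1ℚ * (γ * (bn - dn))
          ≡⟨ cancel (α * (bp - dp)) γ (bn - dn) ⟩
        γ * (- (bn - dn)) ∎))
      where
      open ≡-Reasoning
      0<N = neg-antimono-< n<0
      Q = a p zero
      N = - a n zero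
      α = inv Q 0<p
      γ = inv N 0<N
      bp = b p
      bn = b n
      dp = dot (a p ∘ suc) c
      dn = dot (a n ∘ suc) c
      gap = N * dp + Q * dn - (N * bp + Q * bn)
      pair≤ : N * bp + Q * bn ≤ N * dp + Q * dn
      pair≤ = subst (N * bp + Q * bn ≤_) (dot-linear N Q (a p ∘ suc) (a n ∘ suc) c)
        (All.lookup (map⁻ (++⁻ʳ (map inj₁ zs) sat)) (∈-cartesianProduct⁺ p∈ n∈))
      expand-gap : ∀ α γ Q N bp dp bn dn →
        α * (bp - dp) + α * γ * (N * dp + Q * dn - (N * bp + Q * bn)) ≡
        α * (bp - dp) - (N * γ) * (α * (bp - dp)) - (Q * α) * (γ * (bn - dn))
      expand-gap = solve-∀ ℚ-ring
      cancel : ∀ s γ t → s - 1ℚ * s - 1ℚ * (γ * t) ≡ γ * (- t)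
      cancel = solve-∀ ℚ-ring

    extend : ∃[ c₀ ] All (λ p → lower p ≤ c₀) ps × All (λ n → c₀ ≤ upper n) ns →
      Solution rows a b
    extend (c₀ , l≤c₀ , c₀≤u) = (λ { zero → c₀ ; (suc j) → c j }) ,
      merge (All.map (λ {r} → zero-row r) (map⁻ (++⁻ˡ (map inj₁ zs) sat)))
            (All.map (λ {r} → pos-row r) l≤c₀) (All.map (λ {r} → neg-row r) c₀≤u)
      where
      Row : R → Set
      Row r = b r ≤ a r zero * c₀ + dot (a r ∘ suc) c

      zero-row : ((r , _) : Zero⁰) → b r ≤ dot (a r ∘ suc) c → Row r
      zero-row (r , eq) b≤ = subst (b r ≤_) (sym (trans (cong (λ t → t * c₀ + d) eq)
        (trans (cong (_+ d) (*-zeroˡ c₀)) (+-identityˡ d)))) b≤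
        where d = dot (a r ∘ suc) c

      pos-row : (p : Pos⁺) → lower p ≤ c₀ → Row (proj₁ p)
      pos-row (r , 0<q) l≤ = ≤-by (q * c₀ - (q * inv q 0<q) * (b r - d))
        (subst (λ t → 0ℚ ≤ q * c₀ - t) (sym (*-assoc q (inv q 0<q) (b r - d)))
          (0≤-diff (*-monoʳ (<⇒≤ 0<q) l≤)))
        (trans (lemma q c₀ d (b r)) (cong (λ t → b r + (q * c₀ - t * (b r - d))) (sym (inv-mul q 0<q))))
        where
        q = a r zero
        d = dot (a r ∘ suc) c
        lemma : ∀ q c d b → q * c + d ≡ b + (q * c - 1ℚ * (b - d))
        lemma = solve-∀ ℚ-ring

      neg-row : (n : Neg⁻) → c₀ ≤ upper n → Row (proj₁ n)
      neg-row (r , q<0) ≤u = ≤-by ((N * inv N 0<N) * (- (b r - d)) - N * c₀)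
        (subst (λ t → 0ℚ ≤ t - N * c₀) (sym (*-assoc N (inv N 0<N) (- (b r - d))))
          (0≤-diff (*-monoʳ (<⇒≤ 0<N) ≤u)))
        (trans (lemma (a r zero) c₀ d (b r))
          (cong (λ t → b r + (t * (- (b r - d)) - N * c₀)) (sym (inv-mul N 0<N))))
        where
        N = - a r zero
        0<N = neg-antimono-< q<0
        d = dot (a r ∘ suc) c
        lemma : ∀ q c d b → q * c + d ≡ b + (1ℚ * (- (b - d)) - (- q) * c)
        lemma = solve-∀ ℚ-ring

  conclude : Solution rows′ a′ b′ ⊎ Certificate a′ b′ → Solution rows a b ⊎ Certificate a b
  conclude (inj₁ solution) = inj₁ (back-substitute solution)
  conclude (inj₂ (ws , zeros , 0<b)) = inj₂ (List.concatMap expand ws ,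
    (λ { zero → trans (∑-expand (λ r → a r zero) ws)
                  (∑-zero ws λ (y , r) → trans (cong (proj₁ y *_) (eliminated r)) (*-zeroʳ (proj₁ y)))
       ; (suc j) → trans (∑-expand (λ r → a r (suc j)) ws) (zeros j) }) ,
    subst (0ℚ <_) (sym (∑-expand b ws)) 0<b)

-- Product functionals on blocks

-- A signed measure as a list of weighted atoms. Atoms may repeat, so `mass` is an upper bound for
-- the total variation; only upper bounds enter the estimates.
Measure : Set → Set
Measure X = List (ℚ × X)

∫ : Measure X → (X → ℚ) → ℚ
∫ μ g = ∑ μ λ (q , x) → q * g x

mass : Measure X → ℚ
mass μ = ∑ μ λ (q , _) → ∣ q ∣

negate : Measure X → Measure X
negate = map λ (q , x) → - q , x

∫-negate : ∀ (μ : Measure X) g → ∫ (negate μ) g ≡ - ∫ μ g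
∫-negate μ g = trans (∑-map μ _ _)
  (trans (∑-cong μ λ (q , x) → lemma q (g x))
    (trans (sym (∑-distribˡ-* μ (- 1ℚ) _)) (lemma′ (∫ μ g))))
  where
  lemma : ∀ q t → (- q) * t ≡ (- 1ℚ) * (q * t)
  lemma = solve-∀ ℚ-ring
  lemma′ : ∀ t → (- 1ℚ) * t ≡ - t
  lemma′ = solve-∀ ℚ-ring

mass-negate : ∀ (μ : Measure X) → mass (negate μ) ≡ mass μ
mass-negate μ = trans (∑-map μ _ _) (∑-cong μ λ (q , _) → ∣-p∣≡∣p∣ q)

infixl 6 _⊝_
_⊝_ : Measure X → Measure X → Measure X
μ ⊝ ν = μ ++ negate ν

∫-⊝ : ∀ (μ ν : Measure X) g → ∫ (μ ⊝ ν) g ≡ ∫ μ g - ∫ ν g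
∫-⊝ μ ν g = trans (∑-++ μ (negate ν) _) (cong (∫ μ g +_) (∫-negate ν g))

mass-⊝ : ∀ (μ ν : Measure X) → mass (μ ⊝ ν) ≡ mass μ + mass ν
mass-⊝ μ ν = trans (∑-++ μ (negate ν) _) (cong (mass μ +_) (mass-negate ν))

-- A function on the product as a sum of product terms. Coefficients and factors are functions of
-- the term label, so that integrating out a block changes them while the list of terms stays the
-- same.
evalTensor : ∀ {n} → List τ → (τ → ℚ) → (τ → Fin n → X → ℚ) → (Fin n → X) → ℚ
evalTensor ts c g x = ∑ ts λ t → c t * ∏ (λ i → g t i (x i))

∫⨂ : ∀ {n} → (Fin n → Measure X) → List τ → (τ → ℚ) → (τ → Fin n → X → ℚ) → ℚ
∫⨂ μ ts c g = ∑ ts λ t → c t * ∏ (λ i → ∫ (μ i) (g t i))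

integrateAt : ∀ {n} → Fin (suc n) → Measure X → (τ → ℚ) → (τ → Fin (suc n) → X → ℚ) → τ → ℚ
integrateAt i μ c g t = c t * ∫ μ (g t i)

∫⨂-integrateAt : ∀ {n} (i : Fin (suc n)) (μ : Fin (suc n) → Measure X) (ts : List τ) c g →
  ∫⨂ μ ts c g ≡ ∫⨂ (removeAt μ i) ts (integrateAt i (μ i) c g) (λ t → removeAt (g t) i)
∫⨂-integrateAt i μ ts c g = ∑-cong ts λ t →
  trans (cong (c t *_) (∏-remove {i = i} λ j → ∫ (μ j) (g t j))) (sym (*-assoc (c t) _ _))

-- The formal change of coefficients is the partial integral of the function itself. This is what
-- lets a bound on the values survive the step, although the single terms may be large.
evalTensor-integrateAt : ∀ {n} (i : Fin (suc n)) (μ : Measure X) (ts : List τ) c g x →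
  evalTensor ts (integrateAt i μ c g) (λ t → removeAt (g t) i) x ≡
  ∫ μ (λ y → evalTensor ts c g (insertAt x i y))
evalTensor-integrateAt i μ ts c g x = begin
  ∑ ts (λ t → c t * ∫ μ (g t i) * rest t)
    ≡⟨ ∑-cong ts (λ t → trans (cong (_* rest t) (∑-distribˡ-* μ (c t) _)) (∑-distribʳ-* μ (rest t) _)) ⟩
  ∑ ts (λ t → ∑ μ (λ (q , y) → c t * (q * g t i y) * rest t))
    ≡⟨ ∑-comm ts μ _ ⟩
  ∑ μ (λ (q , y) → ∑ ts (λ t → c t * (q * g t i y) * rest t))
    ≡⟨ ∑-cong μ (λ (q , y) → trans (∑-cong ts (λ t → term q y t)) (sym (∑-distribˡ-* ts q _))) ⟩
  ∑ μ (λ (q , y) → q * evalTensor ts c g (insertAt x i y)) ∎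
  where
  open ≡-Reasoning
  rest = λ t → ∏ (λ j → g t (punchIn i j) (x j))
  lemma : ∀ c q s r → c * (q * s) * r ≡ q * (c * (s * r))
  lemma = solve-∀ ℚ-ring
  term : ∀ q y t → c t * (q * g t i y) * rest t ≡ q * (c t * ∏ (λ j → g t j (insertAt x i y j)))
  term q y t = trans (lemma (c t) q (g t i y) (rest t)) (cong (λ s → q * (c t * s))
    (sym (trans (∏-remove {i = i} λ j → g t j (insertAt x i y j))
      (cong₂ _*_ (cong (g t i) (insertAt-lookup x i y))
        (∏-cong λ j → cong (g t (punchIn i j)) (insertAt-punchIn x i y j))))))

∫-bound : ∀ (μ : Measure X) (F : X → ℚ) {M} → (∀ x → ∣ F x ∣ ≤ M) → ∣ ∫ μ F ∣ ≤ mass μ * M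
∫-bound μ F {M} F≤M = begin
  ∣ ∫ μ F ∣                          ≤⟨ ∑-abs μ _ ⟩
  ∑ μ (λ (q , x) → ∣ q * F x ∣)      ≤⟨ ∑-mono μ (λ (q , x) →
    subst (_≤ ∣ q ∣ * M) (sym (∣p*q∣≡∣p∣*∣q∣ q (F x))) (*-monoʳ (0≤∣p∣ q) (F≤M x))) ⟩
  ∑ μ (λ (q , x) → ∣ q ∣ * M)        ≡⟨ ∑-distribʳ-* μ M _ ⟨
  mass μ * M                         ∎
  where open ≤-Reasoning

integrateAt-bound : ∀ {n} (i : Fin (suc n)) (μ : Measure X) (ts : List τ) c g {B M} →
  mass μ ≤ B → 0ℚ ≤ M → (∀ x → ∣ evalTensor ts c g x ∣ ≤ M) →
  ∀ x → ∣ evalTensor ts (integrateAt i μ c g) (λ t → removeAt (g t) i) x ∣ ≤ B * M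
integrateAt-bound i μ ts c g {B} {M} μ≤B 0≤M P≤M x =
  subst (λ v → ∣ v ∣ ≤ B * M) (sym (evalTensor-integrateAt i μ ts c g x))
    (≤-trans (∫-bound μ _ λ y → P≤M (insertAt x i y)) (*-monoˡ 0≤M μ≤B))

∫⨂-bound : ∀ {n} (μ : Fin n → Measure X) (ts : List τ) c g {M} →
  (∀ i → mass (μ i) ≤ 1ℚ) → 0ℚ ≤ M → (∀ x → ∣ evalTensor ts c g x ∣ ≤ M) →
  ∣ ∫⨂ μ ts c g ∣ ≤ M
∫⨂-bound {n = zero}  μ ts c g μ≤1 0≤M P≤M = P≤M λ ()
∫⨂-bound {n = suc n} μ ts c g {M} μ≤1 0≤M P≤M =
  subst (λ v → ∣ v ∣ ≤ M) (sym (∫⨂-integrateAt zero μ ts c g))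
    (∫⨂-bound (μ ∘ suc) ts (integrateAt zero (μ zero) c g) (λ t → g t ∘ suc) (μ≤1 ∘ suc) 0≤M
      λ x → subst (∣ evalTensor ts (integrateAt zero (μ zero) c g) (λ t → g t ∘ suc) x ∣ ≤_) (*-identityˡ M)
        (integrateAt-bound zero (μ zero) ts c g (μ≤1 zero) 0≤M P≤M x))

≡0⇒*≡0 : ∀ {p} q → p ≡ 0ℚ → p * q ≡ 0ℚ
≡0⇒*≡0 q refl = *-zeroˡ q

argmax : ∀ {n} (d : Fin (suc n) → ℕ) → ∃[ i ] (∀ j → d j ℕ.≤ d i)
argmax {zero}  d = zero , λ { zero → ℕ.≤-refl }
argmax {suc n} d with argmax (d ∘ suc)
... | i , max with d zero ℕ.≤? d (suc i)
...   | yes d₀≤ = suc i , λ { zero → d₀≤ ; (suc j) → max j }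
...   | no  d₀≰ = zero , λ { zero → ℕ.≤-refl ; (suc j) → ℕ.≤-trans (max j) (ℕ.≰⇒≥ d₀≰) }

^-nonNeg : ∀ {q} → 0ℚ ≤ q → ∀ n → 0ℚ ≤ q ^ n
^-nonNeg 0≤q zero    = nonNegative⁻¹ 1ℚ
^-nonNeg 0≤q (suc n) = 0≤* 0≤q (^-nonNeg 0≤q n)

-- The surplus s is the number of differences lam − kap chosen so far minus the
-- number of factors kap.  Since the largest d is processed first, each kap is
-- paid for by an earlier difference with at least as large a d.  At s = 0 a
-- factor kap stops the expansion, and the hypothesis step says that the
-- potential ρ ^ suc s absorbs both branches.
module Walk {β ρ : ℚ} (0≤β : 0ℚ ≤ β) (0≤ρ : 0ℚ ≤ ρ)
            (step : β + (1ℚ + β) * (ρ * ρ) ≤ ρ) where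

  walk : ∀ n (d : Fin n → ℕ) (lam kap : Fin n → Measure X) (ts : List τ)
    (c : τ → ℚ) (g : τ → Fin n → X → ℚ) (e : τ → Fin n → ℕ) (D s b : ℕ) {M : ℚ} →
    (∀ i → mass (lam i) ≤ 1ℚ) → (∀ i → mass (kap i) ≤ β) →
    (∀ t i → e t i ℕ.< d i → ∫ (lam i) (g t i) ≡ ∫ (kap i) (g t i)) →
    (∀ t → c t ≡ 0ℚ ⊎ sumℕ (e t) ℕ.≤ D) →
    0ℚ ≤ M → (∀ x → ∣ evalTensor ts c g x ∣ ≤ M) →
    (∀ i → d i ℕ.≤ b) → 2 ℕ.* D ℕ.+ s ℕ.* b ℕ.< sumℕ d →
    ∣ ∫⨂ lam ts c g ∣ ≤ M * ρ ^ suc s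
  -- Without blocks the hypothesis would place a number below 0: the expansion cannot run out of
  -- blocks unstopped.
  walk zero d lam kap ts c g e D s b lam≤ kap≤ agree deg 0≤M P≤M d≤b ()
  walk {X = X} {τ} (suc n) d lam kap ts c g e D s b {M} lam≤ kap≤ agree deg 0≤M P≤M d≤b room =
    begin
    ∣ ∫⨂ lam ts c g ∣
      ≡⟨ cong ∣_∣ split ⟩
    ∣ ∫⨂ lam′ ts cκ g′ + ∫⨂ lam′ ts cδ g′ ∣
      ≤⟨ ∣p+q∣≤∣p∣+∣q∣ (∫⨂ lam′ ts cκ g′) (∫⨂ lam′ ts cδ g′) ⟩
    ∣ ∫⨂ lam′ ts cκ g′ ∣ + ∣ ∫⨂ lam′ ts cδ g′ ∣
      ≤⟨ +-mono-≤ (down s room) (up (D ℕ.<? d i)) ⟩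
    β * M * ρ ^ s + (1ℚ + β) * M * ρ ^ suc (suc s)
      ≡⟨ collect β M (ρ ^ s) ρ ⟩
    M * ρ ^ s * (β + (1ℚ + β) * (ρ * ρ))
      ≤⟨ *-monoʳ (0≤* 0≤M (^-nonNeg 0≤ρ s)) step ⟩
    M * ρ ^ s * ρ
      ≡⟨ swap M (ρ ^ s) ρ ⟩
    M * ρ ^ suc s ∎
    where
    open ≤-Reasoning
    i = proj₁ (argmax d)
    lam′ = removeAt lam i
    kap′ = removeAt kap i
    d′ = removeAt d i
    g′ : τ → Fin n → X → ℚ
    g′ t = removeAt (g t) i
    e′ : τ → Fin n → ℕ
    e′ t = removeAt (e t) i
    cκ = integrateAt i (kap i) c g
    cδ = integrateAt i (lam i ⊝ kap i) c g

    d≤di : ∀ j → d′ j ℕ.≤ d i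
    d≤di j = proj₂ (argmax d) (punchIn i j)

    Σd : sumℕ d ≡ d i ℕ.+ sumℕ d′
    Σd = sumℕ-remove {i = i} d

    split : ∫⨂ lam ts c g ≡ ∫⨂ lam′ ts cκ g′ + ∫⨂ lam′ ts cδ g′
    split = trans (∫⨂-integrateAt i lam ts c g)
      (trans (∑-cong ts λ t → trans
        (lemma (c t) (∫ (lam i) (g t i)) (∫ (kap i) (g t i)) (∏ (λ j → ∫ (lam′ j) (g′ t j))))
        (cong (λ v → cκ t * ∏ (λ j → ∫ (lam′ j) (g′ t j)) + c t * v * ∏ (λ j → ∫ (lam′ j) (g′ t j)))
          (sym (∫-⊝ (lam i) (kap i) (g t i)))))
        (∑-distrib-+ ts _ _))
      where
      lemma : ∀ c l k r → c * l * r ≡ c * k * r + c * (l - k) * r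
      lemma = solve-∀ ℚ-ring

    collect : ∀ β M r ρ →
      β * M * r + (1ℚ + β) * M * (ρ * (ρ * r)) ≡ M * r * (β + (1ℚ + β) * (ρ * ρ))
    collect = solve-∀ ℚ-ring
    swap : ∀ M r ρ → M * r * ρ ≡ M * (ρ * r)
    swap = solve-∀ ℚ-ring

    Pκ≤ : ∀ x → ∣ evalTensor ts cκ g′ x ∣ ≤ β * M
    Pκ≤ = integrateAt-bound i (kap i) ts c g (kap≤ i) 0≤M P≤M

    Pδ≤ : ∀ x → ∣ evalTensor ts cδ g′ x ∣ ≤ (1ℚ + β) * M
    Pδ≤ = integrateAt-bound i (lam i ⊝ kap i) ts c g
      (subst (_≤ 1ℚ + β) (sym (mass-⊝ (lam i) (kap i))) (+-mono-≤ (lam≤ i) (kap≤ i))) 0≤M P≤M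

    down : ∀ s → 2 ℕ.* D ℕ.+ s ℕ.* b ℕ.< sumℕ d → ∣ ∫⨂ lam′ ts cκ g′ ∣ ≤ β * M * ρ ^ s
    -- Here the expansion stops, and masses at most 1 on the remaining blocks suffice.
    down zero _ = subst (∣ ∫⨂ lam′ ts cκ g′ ∣ ≤_) (sym (*-identityʳ (β * M)))
      (∫⨂-bound lam′ ts cκ g′ (lam≤ ∘ punchIn i) (0≤* 0≤β 0≤M) Pκ≤)
    -- The removed block takes `d i ≤ b` from the sum of the `d`, and the spent unit of surplus
    -- frees at least as much; the degree budget `D` is unchanged. By maximality `d i` bounds the
    -- remaining blocks.
    down (suc s) room = walk n d′ lam′ kap′ ts cκ g′ e′ D s (d i)
      (lam≤ ∘ punchIn i) (kap≤ ∘ punchIn i) (λ t j → agree t (punchIn i j))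
      deg′ (0≤* 0≤β 0≤M) Pκ≤ d≤di
      (ℕ.+-cancelˡ-< (d i) _ _ (ℕ.≤-<-trans shrink (subst (2 ℕ.* D ℕ.+ suc s ℕ.* b ℕ.<_) Σd room)))
      where
      shrink : d i ℕ.+ (2 ℕ.* D ℕ.+ s ℕ.* d i) ℕ.≤ 2 ℕ.* D ℕ.+ suc s ℕ.* b
      shrink = subst (ℕ._≤ 2 ℕ.* D ℕ.+ suc s ℕ.* b) (lemma D s (d i))
        (ℕ.+-monoʳ-≤ (2 ℕ.* D) (ℕ.*-monoʳ-≤ (suc s) (d≤b i)))
        where
        lemma : ∀ D s x → 2 ℕ.* D ℕ.+ suc s ℕ.* x ≡ x ℕ.+ (2 ℕ.* D ℕ.+ s ℕ.* x)
        lemma = ℕSolver.solve-∀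
      deg′ : ∀ t → cκ t ≡ 0ℚ ⊎ sumℕ (e′ t) ℕ.≤ D
      deg′ t with deg t
      ... | inj₁ c≡0 = inj₁ (≡0⇒*≡0 (∫ (kap i) (g t i)) c≡0)
      ... | inj₂ e≤D = inj₂ (ℕ.≤-trans (ℕ.m≤n+m _ (e t i)) (subst (ℕ._≤ D) (sumℕ-remove {i = i} (e t)) e≤D))

    -- An annihilated term stays in the list with coefficient 0, which is why the degree invariant
    -- is a disjunction.
    killed : ∀ t → e t i ℕ.< d i → cδ t ≡ 0ℚ
    killed t e<d = trans (cong (c t *_) (trans (∫-⊝ (lam i) (kap i) (g t i))
      (trans (cong (_- ∫ (kap i) (g t i)) (agree t i e<d)) (+-inverseʳ (∫ (kap i) (g t i)))))) (*-zeroʳ (c t))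

    c≡0⇒cδ≡0 : ∀ t → c t ≡ 0ℚ → cδ t ≡ 0ℚ
    c≡0⇒cδ≡0 t c≡0 = ≡0⇒*≡0 (∫ (lam i ⊝ kap i) (g t i)) c≡0

    eᵢ≤ : ∀ t → sumℕ (e t) ℕ.≤ D → e t i ℕ.+ sumℕ (e′ t) ℕ.≤ D
    eᵢ≤ t = subst (ℕ._≤ D) (sumℕ-remove {i = i} (e t))

    up : _ → ∣ ∫⨂ lam′ ts cδ g′ ∣ ≤ (1ℚ + β) * M * ρ ^ suc (suc s)
    -- No live term can reach degree `d i` in this block, so the difference annihilates all of them.
    up (yes D<d) = subst (_≤ (1ℚ + β) * M * ρ ^ suc (suc s)) (sym (cong ∣_∣ vanishes))
      (0≤* 0≤δM (^-nonNeg 0≤ρ (suc (suc s))))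
      where
      0≤δM : 0ℚ ≤ (1ℚ + β) * M
      0≤δM = 0≤* (0≤+ (nonNegative⁻¹ 1ℚ) 0≤β) 0≤M
      cδ≡0 : ∀ t → cδ t ≡ 0ℚ
      cδ≡0 t with deg t
      ... | inj₁ c≡0 = c≡0⇒cδ≡0 t c≡0
      ... | inj₂ e≤D = killed t (ℕ.≤-<-trans (ℕ.≤-trans (ℕ.m≤m+n _ _) (eᵢ≤ t e≤D)) D<d)
      vanishes : ∫⨂ lam′ ts cδ g′ ≡ 0ℚ
      vanishes = ∑-zero ts λ t → ≡0⇒*≡0 (∏ (λ j → ∫ (lam′ j) (g′ t j))) (cδ≡0 t)
    -- A surviving term has degree at least `d i` in this block and leaves at most `D ∸ d i` to the
    -- others. Thus `2 * D` falls by twice `d i`: one half pays for the removed block, the other is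
    -- the new unit of surplus.
    up (no D≮d) = walk n d′ lam′ kap′ ts cδ g′ e′ (D ℕ.∸ d i) (suc s) (d i)
      (lam≤ ∘ punchIn i) (kap≤ ∘ punchIn i) (λ t j → agree t (punchIn i j))
      deg′ (0≤* (0≤+ (nonNegative⁻¹ 1ℚ) 0≤β) 0≤M) Pδ≤ d≤di room′
      where
      D≡ : d i ℕ.+ (D ℕ.∸ d i) ≡ D
      D≡ = ℕ.m+[n∸m]≡n (ℕ.≮⇒≥ D≮d)
      deg′ : ∀ t → cδ t ≡ 0ℚ ⊎ sumℕ (e′ t) ℕ.≤ D ℕ.∸ d i
      deg′ t with deg t | e t i ℕ.<? d i
      ... | inj₁ c≡0 | _       = inj₁ (c≡0⇒cδ≡0 t c≡0)
      ... | inj₂ _   | yes e<d = inj₁ (killed t e<d)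
      ... | inj₂ e≤D | no  e≮d = inj₂ (ℕ.m+n≤o⇒m≤o∸n _
        (subst (ℕ._≤ D) (ℕ.+-comm (d i) _)
          (ℕ.≤-trans (ℕ.+-monoˡ-≤ _ (ℕ.≮⇒≥ e≮d)) (eᵢ≤ t e≤D))))
      room′ : 2 ℕ.* (D ℕ.∸ d i) ℕ.+ suc s ℕ.* d i ℕ.< sumℕ d′
      room′ = ℕ.+-cancelˡ-< (d i) _ _ (ℕ.≤-<-trans shrink (subst (2 ℕ.* D ℕ.+ s ℕ.* b ℕ.<_) Σd room))
        where
        lemma : ∀ x y s → 2 ℕ.* (x ℕ.+ y) ℕ.+ s ℕ.* x ≡ x ℕ.+ (2 ℕ.* y ℕ.+ suc s ℕ.* x)
        lemma = ℕSolver.solve-∀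
        shrink : d i ℕ.+ (2 ℕ.* (D ℕ.∸ d i) ℕ.+ suc s ℕ.* d i) ℕ.≤ 2 ℕ.* D ℕ.+ s ℕ.* b
        shrink = subst (ℕ._≤ 2 ℕ.* D ℕ.+ s ℕ.* b) (lemma (d i) (D ℕ.∸ d i) s)
          (subst (λ z → 2 ℕ.* z ℕ.+ s ℕ.* d i ℕ.≤ 2 ℕ.* D ℕ.+ s ℕ.* b) (sym D≡)
            (ℕ.+-monoʳ-≤ (2 ℕ.* D) (ℕ.*-monoʳ-≤ s (d≤b i))))

-- Polynomials over ℚ on the sign cube

sgn : Sign → ℚ
sgn Sign.+ = 1ℚ
sgn Sign.- = - 1ℚ

monomial : ∀ {m} → (Fin m → ℕ) → Vec Sign m → ℚ
monomial e x = ∏ λ i → sgn (lookup x i) ^ e i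

Term : ℕ → ℕ → Set
Term m D = ℚ × Σ[ e ∈ (Fin m → ℕ) ] sumℕ e ℕ.≤ D

evalℚ : ∀ {m D} → List (Term m D) → Vec Sign m → ℚ
evalℚ p x = ∑ p λ (q , e , _) → q * monomial e x

-- Degree enters only as an upper bound, witnessed by a representation of the values on the cube;
-- exponents are not reduced modulo squares of signs.
record HasDegree≤ {m} (D : ℕ) (F : Vec Sign m → ℚ) : Set where
  constructor represented
  field
    terms : List (Term m D)
    value : ∀ x → F x ≡ evalℚ terms x

open HasDegree≤ public

monomial-+ : ∀ {m} (e e′ : Fin m → ℕ) x →
  monomial (λ i → e i ℕ.+ e′ i) x ≡ monomial e x * monomial e′ x
monomial-+ e e′ x = trans (∏-cong λ i → ^-homo-* (sgn (lookup x i)) (e i) (e′ i))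
  (∏-distrib-* (λ i → sgn (lookup x i) ^ e i) (λ i → sgn (lookup x i) ^ e′ i))

∑-cartesianProductWith : ∀ {A B C : Set} (h : A → B → C) as bs f →
  ∑ (cartesianProductWith h as bs) f ≡ ∑ as (λ a → ∑ bs (λ b → f (h a b)))
∑-cartesianProductWith h []       bs f = refl
∑-cartesianProductWith h (a ∷ as) bs f =
  trans (∑-++ (map (h a) bs) (cartesianProductWith h as bs) f)
    (cong₂ _+_ (∑-map bs (h a) f) (∑-cartesianProductWith h as bs f))

module _ {m : ℕ} where

  degree-cong : ∀ {D} {F G : Vec Sign m → ℚ} → (∀ x → G x ≡ F x) → HasDegree≤ D F → HasDegree≤ D G
  degree-cong G≗F (represented p v) = represented p λ x → trans (G≗F x) (v x)

  degree-const : ∀ {D} q → HasDegree≤ {m} D (λ _ → q)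
  degree-const {D} q = represented
    ((q , (λ _ → 0) , subst (ℕ._≤ D) (sym (sumℕ-zero m)) ℕ.z≤n) ∷ [])
    λ x → sym (trans (+-identityʳ _) (trans (cong (q *_) (∏-one m)) (*-identityʳ q)))

  degree-weaken : ∀ {D D′} {F : Vec Sign m → ℚ} → D ℕ.≤ D′ → HasDegree≤ D F → HasDegree≤ D′ F
  degree-weaken D≤D′ (represented p v) = represented
    (map (λ (q , e , e≤) → q , e , ℕ.≤-trans e≤ D≤D′) p)
    λ x → trans (v x) (sym (∑-map p _ _))

  degree-+ : ∀ {D} {F G : Vec Sign m → ℚ} →
    HasDegree≤ D F → HasDegree≤ D G → HasDegree≤ D (λ x → F x + G x)
  degree-+ (represented p v) (represented q w) = represented (p ++ q)
    λ x → trans (cong₂ _+_ (v x) (w x)) (sym (∑-++ p q _))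

  degree-* : ∀ {D D′} {F G : Vec Sign m → ℚ} →
    HasDegree≤ D F → HasDegree≤ D′ G → HasDegree≤ (D ℕ.+ D′) (λ x → F x * G x)
  degree-* {D} {D′} (represented p v) (represented q w) = represented (cartesianProductWith times p q)
    λ x → trans (cong₂ _*_ (v x) (w x)) (sym (eval-times x))
    where
    times : Term m D → Term m D′ → Term m (D ℕ.+ D′)
    times (a , e , e≤) (b , e′ , e′≤) = a * b , (λ i → e i ℕ.+ e′ i) ,
      subst (ℕ._≤ D ℕ.+ D′) (sym (sumℕ-distrib-+ e e′)) (ℕ.+-mono-≤ e≤ e′≤)
    lemma : ∀ a b s t → a * b * (s * t) ≡ a * s * (b * t)
    lemma = solve-∀ ℚ-ring
    eval-times : ∀ x → evalℚ (cartesianProductWith times p q) x ≡ evalℚ p x * evalℚ q x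
    eval-times x = trans (∑-cartesianProductWith times p q _)
      (trans (∑-cong p λ (a , e , _) → trans
          (∑-cong q λ (b , e′ , _) → trans (cong (a * b *_) (monomial-+ e e′ x))
            (lemma a b (monomial e x) (monomial e′ x)))
          (sym (∑-distribˡ-* q (a * monomial e x) _)))
        (sym (∑-distribʳ-* p (evalℚ q x) _)))

  degree-neg : ∀ {D} {F : Vec Sign m → ℚ} → HasDegree≤ D F → HasDegree≤ D (λ x → - F x)
  degree-neg {F = F} pF = degree-cong (λ x → lemma (F x)) (degree-* (degree-const {0} (- 1ℚ)) pF)
    where
    lemma : ∀ q → - q ≡ (- 1ℚ) * q
    lemma = solve-∀ ℚ-ring

  degree-- : ∀ {D} {F G : Vec Sign m → ℚ} →
    HasDegree≤ D F → HasDegree≤ D G → HasDegree≤ D (λ x → F x - G x)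
  degree-- pF pG = degree-+ pF (degree-neg pG)

unitExponent : ∀ {m} → Fin m → Fin m → ℕ
unitExponent zero    zero    = 1
unitExponent zero    (suc i) = 0
unitExponent (suc j) zero    = 0
unitExponent (suc j) (suc i) = unitExponent j i

sum-unitExponent : ∀ {m} (j : Fin m) → sumℕ (unitExponent j) ≡ 1
sum-unitExponent {suc m} zero    = cong suc (sumℕ-zero m)
sum-unitExponent         (suc j) = sum-unitExponent j

monomial-unitExponent : ∀ {m} (j : Fin m) x → monomial (unitExponent j) x ≡ sgn (lookup x j)
monomial-unitExponent {suc m} zero (s ∷ x) =
  trans (cong (sgn s * 1ℚ *_) (∏-one m)) (trans (*-identityʳ _) (*-identityʳ (sgn s)))
monomial-unitExponent (suc j) (s ∷ x) = trans (*-identityˡ _) (monomial-unitExponent j x)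

degree-coordinate : ∀ {m} (j : Fin m) → HasDegree≤ 1 (λ x → sgn (lookup x j))
degree-coordinate j = represented ((1ℚ , unitExponent j , ℕ.≤-reflexive (sum-unitExponent j)) ∷ [])
  λ x → sym (trans (+-identityʳ _) (trans (*-identityˡ _) (monomial-unitExponent j x)))

-- Amplification

ℕ→ℚ : ℕ → ℚ
ℕ→ℚ n = ℤ.+ n ℚ./ 1

cubic : ℚ → ℚ → ℚ
cubic c y = y * (c - y * y)

-- Oddness moves the sign of `f x` inside, so both values of `f` reduce to one estimate on a
-- positive interval.
cubic-odd : ∀ c s y → sgn s * cubic c y ≡ cubic c (sgn s * y)
cubic-odd c Sign.+ y = lemma c y
  where
  lemma : ∀ c y → 1ℚ * (y * (c - y * y)) ≡ 1ℚ * y * (c - (1ℚ * y) * (1ℚ * y))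
  lemma = solve-∀ ℚ-ring
cubic-odd c Sign.- y = lemma c y
  where
  lemma : ∀ c y → (- 1ℚ) * (y * (c - y * y)) ≡ (- 1ℚ) * y * (c - ((- 1ℚ) * y) * ((- 1ℚ) * y))
  lemma = solve-∀ ℚ-ring

0≤n/d : ∀ n d .{{_ : ℕ.NonZero d}} → 0ℚ ≤ ℤ.+ n ℚ./ d
0≤n/d n d = nonNegative⁻¹ _ {{normalize-nonNeg n d}}

0≤square : ∀ q → 0ℚ ≤ q * q
0≤square q with ℚ.≤-total 0ℚ q
... | inj₁ 0≤q = 0≤* 0≤q 0≤q
... | inj₂ q≤0 = subst (0ℚ ≤_) (lemma q) (0≤* (neg-antimono-≤ q≤0) (neg-antimono-≤ q≤0))
  where
  lemma : ∀ q → (- q) * (- q) ≡ q * q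
  lemma = solve-∀ ℚ-ring

-- On the half-line `z ≥ 0` the cubic is concave, so its minimum on an interval lies at an endpoint.
-- The condition on `c` says, after multiplication by `u - l`, that the left endpoint has the
-- smaller value.
cubic-lower : ∀ {c l u z} → 0ℚ ≤ l → l * l + l * u + u * u ≤ c → l ≤ z → z ≤ u →
  cubic c l ≤ cubic c z
cubic-lower {c} {l} {u} {z} 0≤l u≤c l≤z z≤u = ≤-by
  ((z - l) * ((u - z) * (u + z + l) + (c - (l * l + l * u + u * u))))
  (0≤* (0≤-diff l≤z) (0≤+ (0≤* (0≤-diff z≤u) (0≤+ (0≤+ 0≤u 0≤z) 0≤l)) (0≤-diff u≤c)))
  (lemma c l u z)
  where
  0≤z = ≤-trans 0≤l l≤z
  0≤u = ≤-trans 0≤z z≤u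
  lemma : ∀ c l u z → z * (c - z * z) ≡
    l * (c - l * l) + (z - l) * ((u - z) * (u + z + l) + (c - (l * l + l * u + u * u)))
  lemma = solve-∀ ℚ-ring

-- For c = 3a² the maximum on the half-line z ≥ 0 is 2a³, attained at z = a.
cubic-upper : ∀ {c a z} → 0ℚ ≤ a → c ≤ a * a + a * a + a * a → 0ℚ ≤ z →
  cubic c z ≤ a * a * (a + a)
cubic-upper {c} {a} {z} 0≤a c≤ 0≤z = ≤-by
  ((z - a) * (z - a) * (z + (a + a)) + z * (a * a + a * a + a * a - c))
  (0≤+ (0≤* (0≤square (z - a)) (0≤+ 0≤z (0≤+ 0≤a 0≤a))) (0≤* 0≤z (0≤-diff c≤)))
  (lemma c a z)
  where
  lemma : ∀ c a z → a * a * (a + a) ≡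
    z * (c - z * z) + ((z - a) * (z - a) * (z + (a + a)) + z * (a * a + a * a + a * a - c))
  lemma = solve-∀ ℚ-ring

Between : ∀ {m} → ℚ → ℚ → BoolFn m → (Vec Sign m → ℚ) → Set
Between a b f F = ∀ x → a ≤ sgn (f x) * F x × sgn (f x) * F x ≤ b

-- 31 = 1 + 5 + 25 gives the first cubic the common value 30 at 1 and 5, which `r₁` scales to 3/5.
-- The value 3 puts the maximum of the second cubic at 1, where it is 2, and `r₂` scales that to
-- 6/5.
c₁ c₂ r₁ r₂ : ℚ
c₁ = ℕ→ℚ 31
r₁ = ℤ.+ 1 ℚ./ 50
c₂ = ℕ→ℚ 3
r₂ = ℤ.+ 3 ℚ./ 5

scaledCubic : ℚ → ℚ → ℚ → ℚ
scaledCubic r c y = r * cubic c y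

scaledCubic-odd : ∀ r c s y → sgn s * scaledCubic r c y ≡ scaledCubic r c (sgn s * y)
scaledCubic-odd r c s y = trans (lemma (sgn s) r (cubic c y)) (cong (r *_) (cubic-odd c s y))
  where
  lemma : ∀ s a t → s * (a * t) ≡ a * (s * t)
  lemma = solve-∀ ℚ-ring

degree-scaledCubic : ∀ {m D} {F : Vec Sign m → ℚ} r c → HasDegree≤ D F →
  HasDegree≤ (3 ℕ.* D) (λ x → scaledCubic r c (F x))
degree-scaledCubic {D = D} r c pF = degree-weaken (ℕ.≤-reflexive (lemma D))
  (degree-* (degree-const {D = 0} r) (degree-* pF (degree-- (degree-const c) (degree-* pF pF))))
  where
  lemma : ∀ D → D ℕ.+ (D ℕ.+ D) ≡ 3 ℕ.* D
  lemma = ℕSolver.solve-∀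

∣∣≤ : ∀ {q e} → - e ≤ q → q ≤ e → ∣ q ∣ ≤ e
∣∣≤ {q} {e} -e≤q q≤e with ∣p∣≡p∨∣p∣≡-p q
... | inj₁ eq = subst (_≤ e) (sym eq) q≤e
... | inj₂ eq = subst (_≤ e) (sym eq) (subst (- q ≤_) (lemma e) (neg-antimono-≤ -e≤q))
  where
  lemma : ∀ e → - (- e) ≡ e
  lemma = solve-∀ ℚ-ring

∣sgn-∣ : ∀ s y → ∣ sgn s - y ∣ ≡ ∣ 1ℚ - sgn s * y ∣
∣sgn-∣ Sign.+ y = cong (λ t → ∣ 1ℚ - t ∣) (sym (*-identityˡ y))
∣sgn-∣ Sign.- y = trans (sym (∣-p∣≡∣p∣ (- 1ℚ - y))) (cong ∣_∣ (lemma y))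
  where
  lemma : ∀ y → - (- 1ℚ - y) ≡ 1ℚ - (- 1ℚ) * y
  lemma = solve-∀ ℚ-ring

1/5ℚ : ℚ
1/5ℚ = ℤ.+ 1 ℚ./ 5

scaledCubic-range : ∀ {r c l u a lo hi z} →
  0ℚ ≤ r → 0ℚ ≤ l → 0ℚ ≤ a →
  l * l + l * u + u * u ≤ c → c ≤ a * a + a * a + a * a →
  lo ≤ scaledCubic r c l → r * (a * a * (a + a)) ≤ hi →
  l ≤ z → z ≤ u → lo ≤ scaledCubic r c z × scaledCubic r c z ≤ hi
scaledCubic-range {r} {c} {l} {u} {a} {lo} {hi} {z} 0≤r 0≤l 0≤a u≤c c≤a lo≤ ≤hi l≤z z≤u =
  ≤-trans lo≤ (*-monoʳ 0≤r (cubic-lower {c} {l} {u} 0≤l u≤c l≤z z≤u)) ,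
  ≤-trans (*-monoʳ 0≤r (cubic-upper {c} {a} 0≤a c≤a (≤-trans 0≤l l≤z))) ≤hi

-- The first cubic has its maximum at the irrational √(31/3); `a₁` lies just above it, and 67/50
-- rounds up the scaled bound that `a₁` yields.
3/5ℚ 4/5ℚ 6/5ℚ 67/50ℚ a₁ : ℚ
3/5ℚ = ℤ.+ 3 ℚ./ 5
4/5ℚ = ℤ.+ 4 ℚ./ 5
6/5ℚ = ℤ.+ 6 ℚ./ 5
67/50ℚ = ℤ.+ 67 ℚ./ 50
a₁ = ℤ.+ 161 ℚ./ 50

-- Abstract because unfolding the rational constants makes type checking very slow.
abstract
  -- The odd map y ↦ r₁ (31 y − y³) takes [1, 5] into [3/5, 67/50], and
  -- z ↦ r₂ (3 z − z³) takes the latter into [4/5, 6/5].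
  amplify : ℚ → ℚ
  amplify = scaledCubic r₂ c₂ ∘ scaledCubic r₁ c₁

  amplify-odd : ∀ s y → sgn s * amplify y ≡ amplify (sgn s * y)
  amplify-odd s y = trans (scaledCubic-odd r₂ c₂ s (scaledCubic r₁ c₁ y))
    (cong (scaledCubic r₂ c₂) (scaledCubic-odd r₁ c₁ s y))

  amplify-range : ∀ {y} → 1ℚ ≤ y → y ≤ ℕ→ℚ 5 → 4/5ℚ ≤ amplify y × amplify y ≤ 6/5ℚ
  amplify-range {y} 1≤y y≤5 = second (first 1≤y y≤5)
    where
    first : 1ℚ ≤ y → y ≤ ℕ→ℚ 5 → 3/5ℚ ≤ scaledCubic r₁ c₁ y × scaledCubic r₁ c₁ y ≤ 67/50ℚ
    first = scaledCubic-range {r₁} {c₁} {1ℚ} {ℕ→ℚ 5} {a₁} {3/5ℚ} {67/50ℚ} {y}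
      (0≤n/d 1 50) (0≤n/d 1 1) (0≤n/d 161 50)
      (from-yes (1ℚ * 1ℚ + 1ℚ * ℕ→ℚ 5 + ℕ→ℚ 5 * ℕ→ℚ 5 ℚ.≤? c₁))
      (from-yes (c₁ ℚ.≤? a₁ * a₁ + a₁ * a₁ + a₁ * a₁))
      (from-yes (3/5ℚ ℚ.≤? scaledCubic r₁ c₁ 1ℚ))
      (from-yes (r₁ * (a₁ * a₁ * (a₁ + a₁)) ℚ.≤? 67/50ℚ))
    second : 3/5ℚ ≤ scaledCubic r₁ c₁ y × scaledCubic r₁ c₁ y ≤ 67/50ℚ → 4/5ℚ ≤ amplify y × amplify y ≤ 6/5ℚ
    second (l≤z , z≤u) = scaledCubic-range {r₂} {c₂} {3/5ℚ} {67/50ℚ} {1ℚ} {4/5ℚ} {6/5ℚ} {scaledCubic r₁ c₁ y}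
      (0≤n/d 3 5) (0≤n/d 3 5) (0≤n/d 1 1)
      (from-yes (3/5ℚ * 3/5ℚ + 3/5ℚ * 67/50ℚ + 67/50ℚ * 67/50ℚ ℚ.≤? c₂))
      (from-yes (c₂ ℚ.≤? 1ℚ * 1ℚ + 1ℚ * 1ℚ + 1ℚ * 1ℚ))
      (from-yes (4/5ℚ ℚ.≤? scaledCubic r₂ c₂ 3/5ℚ))
      (from-yes (r₂ * (1ℚ * 1ℚ * (1ℚ + 1ℚ)) ℚ.≤? 6/5ℚ))
      l≤z z≤u

  amplify-close : ∀ {y} → 1ℚ ≤ y → y ≤ ℕ→ℚ 5 → ∣ 1ℚ - amplify y ∣ ≤ 1/5ℚ
  amplify-close {y} 1≤y y≤5 = close (amplify-range 1≤y y≤5)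
    where
    close : ∀ {v} → 4/5ℚ ≤ v × v ≤ 6/5ℚ → ∣ 1ℚ - v ∣ ≤ 1/5ℚ
    close (4/5≤ , ≤6/5) = ∣∣≤ (+-monoʳ-≤ 1ℚ (neg-antimono-≤ ≤6/5)) (+-monoʳ-≤ 1ℚ (neg-antimono-≤ 4/5≤))

  degree-amplify : ∀ {m K} {F : Vec Sign m → ℚ} → HasDegree≤ K F → HasDegree≤ (9 ℕ.* K) (amplify ∘ F)
  degree-amplify {K = K} {F} pF =
    degree-weaken {F = amplify ∘ F} (ℕ.≤-reflexive (sym (ℕ.*-assoc 3 3 K)))
      (degree-scaledCubic {F = scaledCubic r₁ c₁ ∘ F} r₂ c₂ (degree-scaledCubic {F = F} r₁ c₁ pF))

-- Rational polynomials as real polynomials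

toPoly : ∀ {m D} → List (Term m D) → Poly m
toPoly = map λ (q , e , _) → fromℚ q , e

toPoly-degree : ∀ {m D} (p : List (Term m D)) → Degree≤ D (toPoly p)
toPoly-degree []                = []
toPoly-degree ((q , e , e≤) ∷ p) = e≤ ∷ toPoly-degree p

seq-signℝ : ∀ s k → seq (signℝ s) k ≡ sgn s
seq-signℝ Sign.+ k = refl
seq-signℝ Sign.- k = refl

seq-^ : ∀ x n k → seq (x ^ℝ n) k ≡ seq x k ^ n
seq-^ x zero    k = refl
seq-^ x (suc n) k = cong (seq x k *_) (seq-^ x n k)

seq-product : ∀ {n} (t : Fin n → ℝ) k → seq (productℝ t) k ≡ ∏ (λ i → seq (t i) k)
seq-product {zero}  t k = refl
seq-product {suc n} t k = cong (seq (t zero) k *_) (seq-product (t ∘ suc) k)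

seq-monomial : ∀ {m} (e : Fin m → ℕ) x k →
  seq (productℝ λ i → point x i ^ℝ e i) k ≡ monomial e x
seq-monomial e x k = trans (seq-product (λ i → point x i ^ℝ e i) k)
  (∏-cong λ i → trans (seq-^ (point x i) (e i) k) (cong (_^ e i) (seq-signℝ (lookup x i) k)))

seq-eval-toPoly : ∀ {m D} (p : List (Term m D)) x k → seq (eval (toPoly p) (point x)) k ≡ evalℚ p x
seq-eval-toPoly []                x k = refl
seq-eval-toPoly ((q , e , _) ∷ p) x k = cong₂ _+_ (cong (q *_) (seq-monomial e x k)) (seq-eval-toPoly p x k)

toPoly-approximates : ∀ {m D} {f : BoolFn m} {ε} (p : List (Term m D)) →
  (∀ x → ∣ sgn (f x) - evalℚ p x ∣ ≤ ε) → Approximates (fromℚ ε) f (toPoly p)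
toPoly-approximates {f = f} {ε} p near x = mk≤ℝ λ δ 0<δ → 0 , λ k _ →
  subst (_≤ ε + δ)
    (cong ∣_∣ (sym (cong₂ _-_ (seq-signℝ (f x) k) (seq-eval-toPoly p x k))))
    (≤-trans (near x) (≤-by δ (<⇒≤ 0<δ) refl))

amplified : ∀ {m K} {f : BoolFn m} {F : Vec Sign m → ℚ} →
  HasDegree≤ K F → Between 1ℚ (ℕ→ℚ 5) f F →
  Σ[ p ∈ List (Term m (9 ℕ.* K)) ] (∀ x → ∣ sgn (f x) - evalℚ p x ∣ ≤ 1/5ℚ)
amplified {m} {K} {f} {F} pF bounds = terms pG , λ x →
  subst (λ t → ∣ sgn (f x) - t ∣ ≤ 1/5ℚ) (value pG x) (near x)
  where
  pG : HasDegree≤ (9 ℕ.* K) (amplify ∘ F)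
  pG = degree-amplify {K = K} pF
  near : ∀ x → ∣ sgn (f x) - amplify (F x) ∣ ≤ 1/5ℚ
  near x = subst (_≤ 1/5ℚ)
    (sym (trans (∣sgn-∣ (f x) (amplify (F x))) (cong (λ t → ∣ 1ℚ - t ∣) (amplify-odd (f x) (F x)))))
    (amplify-close {sgn (f x) * F x} (proj₁ (bounds x)) (proj₂ (bounds x)))

-- Minimality ranges over all real polynomials, in particular over the rational one obtained by
-- amplification; 9 is the degree of the two composed cubics.
approxDegree≤ : ∀ {m K d} {f : BoolFn m} {F : Vec Sign m → ℚ} →
  IsApproxDegree (fromℚ 1/5ℚ) f d → HasDegree≤ K F → Between 1ℚ (ℕ→ℚ 5) f F → d ℕ.≤ 9 ℕ.* K
approxDegree≤ {m} {K} {d} {f} (_ , least) pF bounds = conclude (amplified {f = f} pF bounds)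
  where
  conclude : Σ[ p ∈ List (Term m (9 ℕ.* K)) ] (∀ x → ∣ sgn (f x) - evalℚ p x ∣ ≤ 1/5ℚ) → d ℕ.≤ 9 ℕ.* K
  conclude (p , near) = least (9 ℕ.* K) (toPoly p) (toPoly-degree p) (toPoly-approximates {f = f} p near)

-- Dual measures

allPoints : ∀ m → List (Vec Sign m)
allPoints zero    = [] ∷ []
allPoints (suc m) = cartesianProductWith _∷_ (Sign.+ ∷ Sign.- ∷ []) (allPoints m)

∈-signs : ∀ s → s ∈ Sign.+ ∷ Sign.- ∷ []
∈-signs Sign.+ = here refl
∈-signs Sign.- = there (here refl)

∈-allPoints : ∀ {m} (x : Vec Sign m) → x ∈ allPoints m
∈-allPoints []      = here refl
∈-allPoints (s ∷ x) = ∈-cartesianProductWith⁺ _∷_ (∈-signs s) (∈-allPoints x)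

Exponent : ℕ → ℕ → Set
Exponent m K = Σ[ e ∈ (Fin m → ℕ) ] sumℕ e ℕ.≤ K

prependZero : ∀ {m K} → Exponent m K → Exponent (suc m) K
prependZero (e , e≤) = (λ { zero → 0 ; (suc i) → e i }) , e≤

incrementFirst : ∀ {m K} → Exponent (suc m) K → Exponent (suc m) (suc K)
incrementFirst (e , e≤) = (λ { zero → suc (e zero) ; (suc i) → e (suc i) }) , ℕ.s≤s e≤

exponents : ∀ m K → List (Exponent m K)
exponents zero    K       = ((λ ()) , ℕ.z≤n) ∷ []
exponents (suc m) zero    = map prependZero (exponents m zero)
exponents (suc m) (suc K) =
  map prependZero (exponents m (suc K)) ++ map incrementFirst (exponents (suc m) K)

-- Exponents are functions, so membership in the list is expressed up to pointwise equality.
exponents-complete : ∀ m K (e : Fin m → ℕ) → sumℕ e ℕ.≤ K →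
  Any (λ e′ → ∀ i → e i ≡ proj₁ e′ i) (exponents m K)
-- Keeping the first exponent `a` as a separate number lets the recursion lower it together with
-- `K`.
exponents-complete-∷ : ∀ m K a (e : Fin m → ℕ) → a ℕ.+ sumℕ e ℕ.≤ K →
  Any (λ e′ → a ≡ proj₁ e′ zero × (∀ i → e i ≡ proj₁ e′ (suc i))) (exponents (suc m) K)

exponents-complete zero    K e e≤ = here λ ()
exponents-complete (suc m) K e e≤ = Any.map (λ { (p , q) zero → p ; (p , q) (suc i) → q i })
  (exponents-complete-∷ m K (e zero) (e ∘ suc) e≤)

exponents-complete-∷ m zero    zero    e e≤ =
  Any.map⁺ (Any.map (λ q → refl , q) (exponents-complete m zero e e≤))
exponents-complete-∷ m (suc K) zero    e e≤ =
  Any.++⁺ˡ (Any.map⁺ (Any.map (λ q → refl , q) (exponents-complete m (suc K) e e≤)))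
exponents-complete-∷ m (suc K) (suc a) e (ℕ.s≤s e≤) =
  Any.++⁺ʳ (map prependZero (exponents m (suc K)))
    (Any.map⁺ (Any.map (λ (p , q) → cong suc p , q) (exponents-complete-∷ m K a e e≤)))

degree-dot : ∀ {m K} (es : List (Exponent m K)) (c : Fin (List.length es) → ℚ) →
  HasDegree≤ K (λ x → dot (λ j → monomial (proj₁ (List.lookup es j)) x) c)
degree-dot []       c = degree-const 0ℚ
degree-dot (e ∷ es) c = degree-+
  (represented ((c zero , e) ∷ [])
    λ x → trans (*-comm (monomial (proj₁ e) x) (c zero)) (sym (+-identityʳ _)))
  (degree-dot es (c ∘ suc))

dot-scale : ∀ {k} q (a c : Fin k → ℚ) → dot (λ j → q * a j) c ≡ q * dot a c
dot-scale {zero}  q a c = sym (*-zeroʳ q)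
dot-scale {suc k} q a c = trans (cong₂ _+_ (*-assoc q (a zero) (c zero)) (dot-scale q (a ∘ suc) (c ∘ suc)))
  (sym (*-distribˡ-+ q (a zero * c zero) _))

-- Mass at most 1 and correlation 1 force `lam` to be the sign of `f` times a probability measure.
-- The difference `lam ⊝ kap` is a dual polynomial of pure high degree, and `kap` is its deviation
-- from that ideal shape.
record DualMeasures {m} (f : BoolFn m) (d : ℕ) : Set where
  field
    lam kap    : Measure (Vec Sign m)
    lam-mass   : mass lam ≤ 1ℚ
    kap-mass   : mass kap ≤ 1/5ℚ
    correlated : ∫ lam (sgn ∘ f) ≡ 1ℚ
    agree      : ∀ e → sumℕ e ℕ.< d → ∫ lam (monomial e) ≡ ∫ kap (monomial e)

posPart negPart : Sign → ℚ
posPart Sign.+ = 1ℚ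
posPart Sign.- = 0ℚ
negPart Sign.+ = 0ℚ
negPart Sign.- = 1ℚ

posPart-negPart : ∀ s → posPart s - negPart s ≡ sgn s
posPart-negPart Sign.+ = refl
posPart-negPart Sign.- = refl

posPart-nonNeg : ∀ s → 0ℚ ≤ posPart s
posPart-nonNeg Sign.+ = 0≤n/d 1 1
posPart-nonNeg Sign.- = ≤-refl

negPart-nonNeg : ∀ s → 0ℚ ≤ negPart s
negPart-nonNeg Sign.+ = ≤-refl
negPart-nonNeg Sign.- = 0≤n/d 1 1

sgn*sgn : ∀ s → sgn s * sgn s ≡ 1ℚ
sgn*sgn Sign.+ = refl
sgn*sgn Sign.- = refl

∣sgn∣ : ∀ s → ∣ sgn s ∣ ≡ 1ℚ
∣sgn∣ Sign.+ = refl
∣sgn∣ Sign.- = refl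

module _ {m : ℕ} (f : BoolFn m) (K : ℕ) where

  private
    -- The sign selects the side of the constraint at `x`: `+` stands for 1 ≤ f F and `-` for -5 ≤
    -- -f F, where the coefficients of `F` are the unknowns.
    Row : Set
    Row = Sign × Vec Sign m

    basis = exponents m K

    a : Row → Fin (List.length basis) → ℚ
    a (s , x) j = sgn s * sgn (f x) * monomial (proj₁ (List.lookup basis j)) x

    b : Row → ℚ
    b (s , x) = posPart s - ℕ→ℚ 5 * negPart s

    rows : List Row
    rows = cartesianProduct (Sign.+ ∷ Sign.- ∷ []) (allPoints m)

    polynomial : Solution rows a b → ∃[ F ] HasDegree≤ K F × Between 1ℚ (ℕ→ℚ 5) f F
    polynomial (c , sat) = F , degree-dot basis c , λ x →
      subst₂ _≤_ refl (unsign x) (row Sign.+ x) ,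
      subst₂ _≤_ (lemma (sgn (f x) * F x)) refl
        (neg-antimono-≤ (row Sign.- x))
      where
      F : Vec Sign m → ℚ
      F x = dot (λ j → monomial (proj₁ (List.lookup basis j)) x) c
      row : ∀ s x → b (s , x) ≤ sgn s * (sgn (f x) * F x)
      row s x = subst (b (s , x) ≤_) (trans (dot-scale (sgn s * sgn (f x)) _ c) (*-assoc (sgn s) (sgn (f x)) (F x)))
        (All.lookup sat (∈-cartesianProduct⁺ (∈-signs s) (∈-allPoints x)))
      unsign : ∀ x → 1ℚ * (sgn (f x) * F x) ≡ sgn (f x) * F x
      unsign x = *-identityˡ _
      lemma : ∀ t → - ((- 1ℚ) * t) ≡ t
      lemma = solve-∀ ℚ-ring

    measures : Certificate a b → DualMeasures f (suc K)
    measures (ws , zeros , 0<b) = record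
      { lam = part posPart
      ; kap = part negPart
      ; lam-mass = ≤-reflexive (trans (part-mass posPart-nonNeg) αU≡1)
      ; kap-mass = subst (_≤ 1/5ℚ) (sym (part-mass negPart-nonNeg)) αV≤
      ; correlated = trans part-correlated αU≡1
      ; agree = part-agree
      }
      where
      wsum : (Sign → ℚ) → ℚ
      wsum h = ∑ ws λ ((y , _) , (s , _)) → y * h s
      U = wsum posPart
      V = wsum negPart

      0≤V : 0ℚ ≤ V
      0≤V = ∑-nonNeg ws λ ((_ , 0≤y) , (s , _)) → 0≤* 0≤y (negPart-nonNeg s)

      -- `U` and `V` are the total weights of the two kinds of rows. Positivity of U - 5V makes `U`
      -- positive, and after division by `U` it bounds the mass of `kap` by 1/5.
      wsum-b : ∑ ws (λ ((y , _) , r) → y * b r) ≡ U - ℕ→ℚ 5 * V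
      wsum-b = trans (∑-cong ws λ ((y , _) , (s , _)) → lemma y (posPart s) (negPart s))
        (trans (∑-distrib-+ ws _ _) (trans (cong (U +_) (sym (∑-distribˡ-* ws (- ℕ→ℚ 5) _))) (lemma′ U V)))
        where
        lemma : ∀ y p n → y * (p - ℕ→ℚ 5 * n) ≡ y * p + (- ℕ→ℚ 5) * (y * n)
        lemma = solve-∀ ℚ-ring
        lemma′ : ∀ U V → U + (- ℕ→ℚ 5) * V ≡ U - ℕ→ℚ 5 * V
        lemma′ = solve-∀ ℚ-ring

      0<U-5V : 0ℚ < U - ℕ→ℚ 5 * V
      0<U-5V = subst (0ℚ <_) wsum-b 0<b

      0<U : 0ℚ < U
      0<U = <-≤-trans 0<U-5V (≤-by (ℕ→ℚ 5 * V) (0≤* (0≤n/d 5 1) 0≤V) (lemma U V))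
        where
        lemma : ∀ U V → U ≡ U - ℕ→ℚ 5 * V + ℕ→ℚ 5 * V
        lemma = solve-∀ ℚ-ring

      α : ℚ
      α = ℚ.1/_ U {{pos⇒nonZero U {{positive 0<U}}}}
      0≤α : 0ℚ ≤ α
      0≤α = <⇒≤ (positive⁻¹ α {{1/pos⇒pos U {{positive 0<U}}}})
      αU≡1 : α * U ≡ 1ℚ
      αU≡1 = *-inverseˡ U {{pos⇒nonZero U {{positive 0<U}}}}

      αV≤ : α * V ≤ 1/5ℚ
      αV≤ = ≤-by (1/5ℚ * (α * (U - ℕ→ℚ 5 * V))) (0≤* (0≤n/d 1 5) (0≤* 0≤α (<⇒≤ 0<U-5V)))
        (sym (trans (lemma α U V) (trans (cong (1/5ℚ *_) αU≡1) (*-identityʳ 1/5ℚ))))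
        where
        lemma : ∀ α U V → α * V + 1/5ℚ * (α * (U - ℕ→ℚ 5 * V)) ≡ 1/5ℚ * (α * U)
        lemma = solve-∀ ℚ-ring

      part : (Sign → ℚ) → Measure (Vec Sign m)
      part h = map (λ ((y , _) , (s , x)) → α * (y * h s) * sgn (f x) , x) ws

      part-mass : ∀ {h} → (∀ s → 0ℚ ≤ h s) → mass (part h) ≡ α * wsum h
      part-mass {h} 0≤h = trans (∑-map ws _ _) (trans (∑-cong ws entry) (sym (∑-distribˡ-* ws α _)))
        where
        entry : ∀ w → ∣ α * (proj₁ (proj₁ w) * h (proj₁ (proj₂ w))) * sgn (f (proj₂ (proj₂ w))) ∣ ≡
                      α * (proj₁ (proj₁ w) * h (proj₁ (proj₂ w)))
        entry ((y , 0≤y) , (s , x)) = trans (∣p*q∣≡∣p∣*∣q∣ (α * (y * h s)) (sgn (f x)))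
          (trans (cong₂ _*_ (0≤p⇒∣p∣≡p {α * (y * h s)} (0≤* 0≤α (0≤* 0≤y (0≤h s)))) (∣sgn∣ (f x)))
            (*-identityʳ (α * (y * h s))))

      part-correlated : ∫ (part posPart) (sgn ∘ f) ≡ α * U
      part-correlated = trans (∑-map ws _ _) (trans (∑-cong ws λ ((y , _) , (s , x)) →
        trans (*-assoc (α * (y * posPart s)) (sgn (f x)) (sgn (f x)))
          (trans (cong (α * (y * posPart s) *_) (sgn*sgn (f x))) (*-identityʳ _)))
        (sym (∑-distribˡ-* ws α _)))

      ∫-part : ∀ h g → ∫ (part h) g ≡ ∑ ws λ ((y , _) , (s , x)) → α * (y * h s) * sgn (f x) * g x
      ∫-part h g = ∑-map ws _ _

      part-agree : ∀ e → sumℕ e ℕ.< suc K → ∫ (part posPart) (monomial e) ≡ ∫ (part negPart) (monomial e)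
      part-agree e (ℕ.s≤s e≤K) = begin
        ∫ (part posPart) (monomial e)
          ≡⟨ ∫-part posPart (monomial e) ⟩
        ∑ ws (λ ((y , _) , (s , x)) → α * (y * posPart s) * sgn (f x) * monomial e x)
          -- As `posPart s` exceeds `negPart s` by `sgn s`, the two integrals differ by `α` times
          -- column `j` of the certificate, which vanishes.
          ≡⟨ ∑-cong ws (λ ((y , _) , (s , x)) → entry y s x) ⟩
        ∑ ws (λ ((y , _) , (s , x)) →
          α * (y * negPart s) * sgn (f x) * monomial e x + α * (y * a (s , x) j))
          ≡⟨ ∑-distrib-+ ws _ _ ⟩
        ∑ ws (λ ((y , _) , (s , x)) → α * (y * negPart s) * sgn (f x) * monomial e x) +
        ∑ ws (λ ((y , _) , r) → α * (y * a r j))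
          ≡⟨ cong₂ _+_ (sym (∫-part negPart (monomial e)))
               (trans (sym (∑-distribˡ-* ws α _)) (trans (cong (α *_) (zeros j)) (*-zeroʳ α))) ⟩
        ∫ (part negPart) (monomial e) + 0ℚ
          ≡⟨ +-identityʳ _ ⟩
        ∫ (part negPart) (monomial e) ∎
        where
        open ≡-Reasoning
        found = exponents-complete m K e e≤K
        j = Any.index found
        lemma : ∀ α y p n f e → α * (y * p) * f * e ≡ α * (y * n) * f * e + α * (y * ((p - n) * f * e))
        lemma = solve-∀ ℚ-ring
        entry : ∀ y s x → α * (y * posPart s) * sgn (f x) * monomial e x ≡
          α * (y * negPart s) * sgn (f x) * monomial e x + α * (y * a (s , x) j)
        entry y s x = trans (lemma α y (posPart s) (negPart s) (sgn (f x)) (monomial e x))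
          (cong (λ t → α * (y * negPart s) * sgn (f x) * monomial e x + α * (y * t))
            (cong₂ _*_ (cong (_* sgn (f x)) (posPart-negPart s))
              (∏-cong λ i → cong (sgn (lookup x i) ^_) (Any.lookup-index found i))))

  polynomialOrDual : (∃[ F ] HasDegree≤ K F × Between 1ℚ (ℕ→ℚ 5) f F) ⊎ DualMeasures f (suc K)
  polynomialOrDual with farkas _ rows a b
  ... | inj₁ solution    = inj₁ (polynomial solution)
  ... | inj₂ certificate = inj₂ (measures certificate)

-- At `d = 0` the agreement is vacuous, so a point mass weighted by the value of `f` at its point
-- serves.
trivialDual : ∀ {m} (f : BoolFn m) → DualMeasures f 0
trivialDual {m} f = record
  { lam = (sgn (f x₀) , x₀) ∷ []
  ; kap = []
  ; lam-mass = ≤-reflexive (trans (+-identityʳ _) (∣sgn∣ (f x₀)))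
  ; kap-mass = 0≤n/d 1 5
  ; correlated = trans (+-identityʳ _) (sgn*sgn (f x₀))
  ; agree = λ _ ()
  }
  where
  x₀ = Vec.replicate m Sign.+

dualMeasures : ∀ {m d} {f : BoolFn m} → IsApproxDegree (fromℚ 1/5ℚ) f d →
  ∃[ d′ ] d ℕ.≤ 9 ℕ.* d′ × DualMeasures f d′
dualMeasures {d = zero}  {f} _   = 0 , ℕ.z≤n , trivialDual f
-- `d / 9` is the largest `K` with `9 * K < suc d`. Amplifying a polynomial of that degree would
-- beat the minimum, while the next degree `suc K` satisfies `suc d ≤ 9 * suc K`.
dualMeasures {d = suc d} {f} deg with polynomialOrDual f (d ℕ./ 9)
... | inj₂ dual = suc (d ℕ./ 9) , d<9*[1+d/9] , dual
  where
  d<9*[1+d/9] : d ℕ.< 9 ℕ.* suc (d ℕ./ 9)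
  d<9*[1+d/9] = begin-strict
    d                            ≡⟨ ℕ.m≡m%n+[m/n]*n d 9 ⟩
    d ℕ.% 9 ℕ.+ d ℕ./ 9 ℕ.* 9    <⟨ ℕ.+-monoˡ-< (d ℕ./ 9 ℕ.* 9) (ℕ.m%n<n d 9) ⟩
    suc (d ℕ./ 9) ℕ.* 9          ≡⟨ ℕ.*-comm (suc (d ℕ./ 9)) 9 ⟩
    9 ℕ.* suc (d ℕ./ 9)          ∎
    where open ℕ.≤-Reasoning
... | inj₁ (F , pF , bounds) = contradiction (approxDegree≤ {f = f} deg pF bounds)
  (ℕ.<⇒≱ (ℕ.s≤s (subst (ℕ._≤ d) (ℕ.*-comm (d ℕ./ 9) 9) (ℕ.m/n*n≤m d 9))))

-- The degree of an XOR

open SumCombine ℕ.+-0-commutativeMonoid using () renaming (sum-combine to sumℕ-combine)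
open SumCombine *-1-commutativeMonoid using () renaming (sum-combine to ∏-combine)

join : ∀ {n m} → (Fin n → Vec Sign m) → Vec Sign (n ℕ.* m)
join {n} {m} x = Vec.tabulate λ k → uncurry (λ i j → lookup (x i) j) (remQuot {n} m k)

lookup-join : ∀ {n m} (x : Fin n → Vec Sign m) i j → lookup (join x) (combine i j) ≡ lookup (x i) j
lookup-join {n} {m} x i j = trans (Vec.lookup∘tabulate _ (combine i j))
  (cong (uncurry λ i j → lookup (x i) j) (Fin.remQuot-combine {n} i j))

block-join : ∀ {n m} (x : Fin n → Vec Sign m) i → block {n} {m} i (join x) ≡ x i
block-join x i = trans (Vec.tabulate-cong (lookup-join x i)) (Vec.tabulate∘lookup (x i))

sgn-* : ∀ s t → sgn (s Sign.* t) ≡ sgn s * sgn t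
sgn-* Sign.+ Sign.+ = refl
sgn-* Sign.+ Sign.- = refl
sgn-* Sign.- Sign.+ = refl
sgn-* Sign.- Sign.- = refl

sgn-product : ∀ {n} (s : Fin n → Sign) → sgn (productSign s) ≡ ∏ (sgn ∘ s)
sgn-product {zero}  s = refl
sgn-product {suc n} s = trans (sgn-* (s zero) _) (cong (sgn (s zero) *_) (sgn-product (s ∘ suc)))

sgn-⨂-join : ∀ {n m} (f : Fin n → BoolFn m) x → sgn (⨂ f (join x)) ≡ ∏ (λ i → sgn (f i (x i)))
sgn-⨂-join f x = trans (sgn-product λ i → f i (block i (join x)))
  (∏-cong λ i → cong (sgn ∘ f i) (block-join x i))

≤-sumℕ : ∀ {n} (d : Fin n → ℕ) i → d i ℕ.≤ sumℕ d
≤-sumℕ d zero    = ℕ.m≤m+n (d zero) _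
≤-sumℕ d (suc i) = ℕ.≤-trans (≤-sumℕ (d ∘ suc) i) (ℕ.m≤n+m _ (d zero))

9/20ℚ 29/20ℚ 1/3ℚ : ℚ
9/20ℚ = ℤ.+ 9 ℚ./ 20
29/20ℚ = ℤ.+ 29 ℚ./ 20
1/3ℚ = ℤ.+ 1 ℚ./ 3

module XOR {n m : ℕ} (f : Fin n → BoolFn m) (d : Fin n → ℕ) (dual : ∀ i → DualMeasures (f i) (d i))
  {D} {P : Vec Sign (n ℕ.* m) → ℚ} (pP : HasDegree≤ D P)
  (close : ∀ x → ∣ sgn (⨂ f x) - P x ∣ ≤ 9/20ℚ) where

  private
    open DualMeasures
    T : Set
    T = Term (n ℕ.* m) D
    ts : List T
    ts = terms pP

    c : T → ℚ
    c = proj₁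

    blockExponent : T → Fin n → Fin m → ℕ
    blockExponent (_ , e , _) i j = e (combine i j)

    g : T → Fin n → Vec Sign m → ℚ
    g t i = monomial (blockExponent t i)

    V : ℚ
    V = ∫⨂ (lam ∘ dual) ts c g

    evalTensor-P : ∀ x → evalTensor ts c g x ≡ P (join x)
    evalTensor-P x = sym (trans (value pP (join x)) (∑-cong ts λ (q , e , _) →
      cong (q *_) (trans (∏-combine n m _)
        (∏-cong {n} λ i → ∏-cong {m} λ j → cong (λ s → sgn s ^ e (combine i j)) (lookup-join x i j)))))

    -- The terms of ⨂ f − P, with nothing standing for ⨂ f.
    ts′ : List (Maybe T)
    ts′ = nothing ∷ map just ts

    c′ : Maybe T → ℚ
    c′ nothing  = 1ℚ
    c′ (just t) = - 1ℚ * c t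

    g′ : Maybe T → Fin n → Vec Sign m → ℚ
    g′ nothing  i = sgn ∘ f i
    g′ (just t) i = g t i

    difference : ∀ q (r : T → ℚ) (h : Maybe T → ℚ) → h nothing ≡ q → (∀ t → h (just t) ≡ - 1ℚ * r t) →
      ∑ ts′ h ≡ q - ∑ ts r
    difference q r h eq eqs = cong₂ _+_ eq (trans (∑-map ts just h)
      (trans (∑-cong ts eqs) (trans (sym (∑-distribˡ-* ts (- 1ℚ) r)) (lemma (∑ ts r)))))
      where
      lemma : ∀ q → - 1ℚ * q ≡ - q
      lemma = solve-∀ ℚ-ring

    evalTensor-difference : ∀ x → evalTensor ts′ c′ g′ x ≡ sgn (⨂ f (join x)) - P (join x)
    evalTensor-difference x = trans
      (difference (∏ λ i → sgn (f i (x i))) (λ t → c t * ∏ (λ i → g t i (x i)))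
        (λ t → c′ t * ∏ (λ i → g′ t i (x i)))
        (*-identityˡ (∏ λ i → sgn (f i (x i)))) (λ t → *-assoc (- 1ℚ) (c t) (∏ λ i → g t i (x i))))
      (cong₂ _-_ (sym (sgn-⨂-join f x)) (evalTensor-P x))

    ∫⨂-difference : ∫⨂ (lam ∘ dual) ts′ c′ g′ ≡ 1ℚ - V
    ∫⨂-difference = trans
      (difference (∏ λ i → ∫ (lam (dual i)) (sgn ∘ f i)) (λ t → c t * ∏ (λ i → ∫ (lam (dual i)) (g t i)))
        (λ t → c′ t * ∏ (λ i → ∫ (lam (dual i)) (g′ t i)))
        (*-identityˡ (∏ λ i → ∫ (lam (dual i)) (sgn ∘ f i)))
        (λ t → *-assoc (- 1ℚ) (c t) (∏ λ i → ∫ (lam (dual i)) (g t i))))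
      (cong (_- V) (trans (∏-cong λ i → correlated (dual i)) (∏-one n)))

    near-one : ∣ 1ℚ - V ∣ ≤ 9/20ℚ
    near-one = subst (λ t → ∣ t ∣ ≤ 9/20ℚ) ∫⨂-difference
      (∫⨂-bound (lam ∘ dual) ts′ c′ g′ (λ i → lam-mass (dual i)) (0≤n/d 9 20)
        λ x → subst (λ t → ∣ t ∣ ≤ 9/20ℚ) (sym (evalTensor-difference x)) (close (join x)))

    P-bound : ∀ x → ∣ P x ∣ ≤ 29/20ℚ
    P-bound x = begin
      ∣ P x ∣                           ≡⟨ cong ∣_∣ (lemma s (P x)) ⟩
      ∣ s + - (s - P x) ∣               ≤⟨ ∣p+q∣≤∣p∣+∣q∣ s (- (s - P x)) ⟩
      ∣ s ∣ + ∣ - (s - P x) ∣           ≡⟨ cong₂ _+_ (∣sgn∣ (⨂ f x)) (∣-p∣≡∣p∣ (s - P x)) ⟩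
      1ℚ + ∣ s - P x ∣                  ≤⟨ +-monoʳ-≤ 1ℚ (close x) ⟩
      1ℚ + 9/20ℚ                        ≡⟨ refl ⟩
      29/20ℚ                            ∎
      where
      open ≤-Reasoning
      s = sgn (⨂ f x)
      lemma : ∀ s p → p ≡ s + - (s - p)
      lemma = solve-∀ ℚ-ring

    far-from-one : 2 ℕ.* D ℕ.< sumℕ d → ∣ V ∣ ≤ 29/20ℚ * 1/3ℚ ^ 1
    far-from-one 2D<Σd = walk n d (lam ∘ dual) (kap ∘ dual) ts c g (λ t i → sumℕ (blockExponent t i))
      -- The surplus starts at 0, so the bound on the `d i` enters multiplied by 0 and may be as
      -- crude as their sum.
      D 0 (sumℕ d) (λ i → lam-mass (dual i)) (λ i → kap-mass (dual i))
      (λ t i → agree (dual i) (blockExponent t i))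
      (λ (_ , e , e≤D) → inj₂ (subst (ℕ._≤ D) (sumℕ-combine n m e) e≤D))
      (0≤n/d 29 20) (λ x → subst (λ t → ∣ t ∣ ≤ 29/20ℚ) (sym (evalTensor-P x)) (P-bound (join x)))
      (≤-sumℕ d) (subst (ℕ._< sumℕ d) (sym (ℕ.+-identityʳ (2 ℕ.* D))) 2D<Σd)
      where
      -- The inequality is tight: 1/5 + 6/5 · 1/9 = 1/3.
      open Walk {β = 1/5ℚ} {ρ = 1/3ℚ} (0≤n/d 1 5) (0≤n/d 1 3)
        (from-yes (1/5ℚ + (1ℚ + 1/5ℚ) * (1/3ℚ * 1/3ℚ) ℚ.≤? 1/3ℚ))

    1≤∣1-V∣+∣V∣ : 1ℚ ≤ ∣ 1ℚ - V ∣ + ∣ V ∣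
    1≤∣1-V∣+∣V∣ = subst (_≤ ∣ 1ℚ - V ∣ + ∣ V ∣) (cong ∣_∣ (lemma V)) (∣p+q∣≤∣p∣+∣q∣ (1ℚ - V) V)
      where
      lemma : ∀ v → 1ℚ - v + v ≡ 1ℚ
      lemma = solve-∀ ℚ-ring

  xor-degree : sumℕ d ℕ.≤ 2 ℕ.* D
  xor-degree with sumℕ d ℕ.≤? 2 ℕ.* D
  ... | yes Σd≤2D = Σd≤2D
  ... | no  Σd≰2D = contradiction
    (≤-trans 1≤∣1-V∣+∣V∣ (+-mono-≤ near-one (far-from-one (ℕ.≰⇒> Σd≰2D))))
    -- 9/20 + 29/60 = 14/15. In general an error δ gives δ + (1 + δ)/3, which is below 1 exactly for
    -- δ < 1/2.
    (from-no (1ℚ ℚ.≤? 9/20ℚ + 29/20ℚ * 1/3ℚ ^ 1))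

-- The real and the complex numbers

-- Arithmetic is termwise, so every ring law holds at each index by the rational one; limits matter
-- only for congruence and transitivity.
pointwise : ∀ {x y} → (∀ k → seq x k ≡ seq y k) → x ≈ℝ y
pointwise {x} {y} eq = mk≈ℝ λ ε 0<ε → 0 , λ k _ →
  subst (_< ε) (sym (cong ∣_∣ (trans (cong (_- seq y k) (eq k)) (+-inverseʳ (seq y k))))) 0<ε

≈ℝ-refl : ∀ {x} → x ≈ℝ x
≈ℝ-refl {x} = pointwise {x} {x} λ _ → refl

∣-∣-swap : ∀ p q → ∣ p - q ∣ ≡ ∣ q - p ∣
∣-∣-swap p q = trans (sym (∣-p∣≡∣p∣ (p - q))) (cong ∣_∣ (lemma p q))
  where
  lemma : ∀ p q → - (p - q) ≡ q - p
  lemma = solve-∀ ℚ-ring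

≈ℝ-sym : ∀ {x y} → x ≈ℝ y → y ≈ℝ x
≈ℝ-sym {x} {y} x≈y = mk≈ℝ λ ε 0<ε → proj₁ (eventually≈ x≈y ε 0<ε) , λ k N≤k →
  subst (_< ε) (∣-∣-swap (seq x k) (seq y k)) (proj₂ (eventually≈ x≈y ε 0<ε) k N≤k)

½ε : ∀ {ε} → 0ℚ < ε → 0ℚ < ℚ.½ * ε
½ε 0<ε = *-monoʳ-<-pos ℚ.½ 0<ε

halves : ∀ ε → ℚ.½ * ε + ℚ.½ * ε ≡ ε
halves ε = trans (sym (*-distribʳ-+ ε ℚ.½ ℚ.½)) (*-identityˡ ε)

-- The ε/2 argument common to transitivity and to the congruence of addition.
≈ℝ-by : ∀ {x x′ y y′ u u′} → x ≈ℝ x′ → y ≈ℝ y′ →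
  (∀ k → ∣ seq u k - seq u′ k ∣ ≤ ∣ seq x k - seq x′ k ∣ + ∣ seq y k - seq y′ k ∣) → u ≈ℝ u′
≈ℝ-by {x} {x′} {y} {y′} {u} {u′} x≈ y≈ bound = mk≈ℝ λ ε 0<ε →
  go ε (eventually≈ x≈ (ℚ.½ * ε) (½ε 0<ε)) (eventually≈ y≈ (ℚ.½ * ε) (½ε 0<ε))
  where
  go : ∀ ε → ∃[ M ] (∀ i → M ℕ.≤ i → ∣ seq x i - seq x′ i ∣ < ℚ.½ * ε) →
    ∃[ N ] (∀ i → N ℕ.≤ i → ∣ seq y i - seq y′ i ∣ < ℚ.½ * ε) →
    ∃[ K ] (∀ i → K ℕ.≤ i → ∣ seq u i - seq u′ i ∣ < ε)
  go ε (M , nearx) (N , neary) = M ℕ.⊔ N , λ i ≤i →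
    ≤-<-trans (bound i) (subst (∣ seq x i - seq x′ i ∣ + ∣ seq y i - seq y′ i ∣ <_) (halves ε)
      (+-mono-< (nearx i (ℕ.m⊔n≤o⇒m≤o M N ≤i)) (neary i (ℕ.m⊔n≤o⇒n≤o M N ≤i))))

≈ℝ-trans : ∀ {x y z} → x ≈ℝ y → y ≈ℝ z → x ≈ℝ z
≈ℝ-trans {x} {y} {z} x≈y y≈z = ≈ℝ-by {x} {y} {y} {z} {x} {z} x≈y y≈z λ k →
  subst (λ t → ∣ t ∣ ≤ ∣ seq x k - seq y k ∣ + ∣ seq y k - seq z k ∣)
    (lemma (seq x k) (seq y k) (seq z k)) (∣p+q∣≤∣p∣+∣q∣ (seq x k - seq y k) (seq y k - seq z k))
  where
  lemma : ∀ x y z → (x - y) + (y - z) ≡ x - z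
  lemma = solve-∀ ℚ-ring

+ℝ-cong : ∀ {x x′ y y′} → x ≈ℝ x′ → y ≈ℝ y′ → x +ℝ y ≈ℝ x′ +ℝ y′
+ℝ-cong {x} {x′} {y} {y′} x≈ y≈ = ≈ℝ-by {x} {x′} {y} {y′} {x +ℝ y} {x′ +ℝ y′} x≈ y≈ λ k →
  subst (λ t → ∣ t ∣ ≤ ∣ seq x k - seq x′ k ∣ + ∣ seq y k - seq y′ k ∣)
    (lemma (seq x k) (seq x′ k) (seq y k) (seq y′ k)) (∣p+q∣≤∣p∣+∣q∣ (seq x k - seq x′ k) (seq y k - seq y′ k))
  where
  lemma : ∀ x x′ y y′ → (x - x′) + (y - y′) ≡ (x + y) - (x′ + y′)
  lemma = solve-∀ ℚ-ring

-ℝ-cong : ∀ {x y} → x ≈ℝ y → -ℝ x ≈ℝ -ℝ y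
-ℝ-cong {x} {y} x≈y = mk≈ℝ λ ε 0<ε → proj₁ (eventually≈ x≈y ε 0<ε) , λ k N≤k →
  subst (_< ε) (trans (sym (∣-p∣≡∣p∣ (seq x k - seq y k))) (cong ∣_∣ (lemma (seq x k) (seq y k))))
    (proj₂ (eventually≈ x≈y ε 0<ε) k N≤k)
  where
  lemma : ∀ x y → - (x - y) ≡ (- x) - (- y)
  lemma = solve-∀ ℚ-ring

eventually-bounded : ∀ x → ∃[ B ] 0ℚ < B × ∃[ N ] (∀ k → N ℕ.≤ k → ∣ seq x k ∣ ≤ B)
eventually-bounded x = go (cauchy x 1ℚ (positive⁻¹ 1ℚ))
  where
  lemma : ∀ p q → q + (p - q) ≡ p
  lemma = solve-∀ ℚ-ring
  go : ∃[ N ] (∀ i j → N ℕ.≤ i → N ℕ.≤ j → ∣ seq x i - seq x j ∣ < 1ℚ) → _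
  go (N , near) = ∣ seq x N ∣ + 1ℚ , +-mono-≤-< (0≤∣p∣ (seq x N)) (positive⁻¹ 1ℚ) , N , λ k N≤k →
    ≤-trans (subst (λ t → ∣ t ∣ ≤ ∣ seq x N ∣ + ∣ seq x k - seq x N ∣) (lemma (seq x k) (seq x N))
        (∣p+q∣≤∣p∣+∣q∣ (seq x N) (seq x k - seq x N)))
      (+-monoʳ-≤ ∣ seq x N ∣ (<⇒≤ (near k N N≤k ℕ.≤-refl)))

*ℝ-congˡ : ∀ z {x y} → x ≈ℝ y → z *ℝ x ≈ℝ z *ℝ y
*ℝ-congˡ z {x} {y} x≈y = go (eventually-bounded z)
  where
  lemma : ∀ z x y → z * x - z * y ≡ z * (x - y)
  lemma = solve-∀ ℚ-ring
  go : ∃[ B ] 0ℚ < B × ∃[ N ] (∀ k → N ℕ.≤ k → ∣ seq z k ∣ ≤ B) → z *ℝ x ≈ℝ z *ℝ y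
  go (B , 0<B , M , z≤B) = mk≈ℝ λ ε 0<ε → near ε 0<ε
    where
    r = ℚ.1/_ B {{pos⇒nonZero B {{positive 0<B}}}}
    0<r : 0ℚ < r
    0<r = positive⁻¹ r {{1/pos⇒pos B {{positive 0<B}}}}
    Brε≡ε : ∀ ε → B * (r * ε) ≡ ε
    Brε≡ε ε = trans (sym (*-assoc B r ε))
      (trans (cong (_* ε) (*-inverseʳ B {{pos⇒nonZero B {{positive 0<B}}}})) (*-identityˡ ε))
    near : ∀ ε → 0ℚ < ε → ∃[ N ] (∀ k → N ℕ.≤ k → ∣ seq z k * seq x k - seq z k * seq y k ∣ < ε)
    near ε 0<ε = from (eventually≈ x≈y (r * ε)
        (positive⁻¹ (r * ε) {{pos*pos⇒pos r {{positive 0<r}} ε {{positive 0<ε}}}}))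
      where
      from : ∃[ N ] (∀ k → N ℕ.≤ k → ∣ seq x k - seq y k ∣ < r * ε) → _
      from (N , x-y<) = M ℕ.⊔ N , λ k ≤k → begin-strict
        ∣ seq z k * seq x k - seq z k * seq y k ∣
          ≡⟨ cong ∣_∣ (lemma (seq z k) (seq x k) (seq y k)) ⟩
        ∣ seq z k * (seq x k - seq y k) ∣
          ≡⟨ ∣p*q∣≡∣p∣*∣q∣ (seq z k) (seq x k - seq y k) ⟩
        ∣ seq z k ∣ * ∣ seq x k - seq y k ∣
          ≤⟨ *-monoˡ (0≤∣p∣ (seq x k - seq y k)) (z≤B k (ℕ.m⊔n≤o⇒m≤o M N ≤k)) ⟩
        B * ∣ seq x k - seq y k ∣
          <⟨ *-monoʳ-<-pos B {{positive 0<B}} (x-y< k (ℕ.m⊔n≤o⇒n≤o M N ≤k)) ⟩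
        B * (r * ε)
          ≡⟨ Brε≡ε ε ⟩
        ε ∎
        where open ≤-Reasoning

*ℝ-comm : ∀ x y → x *ℝ y ≈ℝ y *ℝ x
*ℝ-comm x y = pointwise {x *ℝ y} {y *ℝ x} λ k → *-comm (seq x k) (seq y k)

*ℝ-cong : ∀ {x x′ y y′} → x ≈ℝ x′ → y ≈ℝ y′ → x *ℝ y ≈ℝ x′ *ℝ y′
*ℝ-cong {x} {x′} {y} {y′} x≈ y≈ = ≈ℝ-trans {x *ℝ y} {x *ℝ y′} {x′ *ℝ y′} (*ℝ-congˡ x y≈)
  (≈ℝ-trans {x *ℝ y′} {y′ *ℝ x} {x′ *ℝ y′} (*ℝ-comm x y′)
    (≈ℝ-trans {y′ *ℝ x} {y′ *ℝ x′} {x′ *ℝ y′} (*ℝ-congˡ y′ x≈) (*ℝ-comm y′ x′)))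

pointwiseℂ : ∀ {z w} → (∀ k → seq (re z) k ≡ seq (re w) k) → (∀ k → seq (im z) k ≡ seq (im w) k) → z ≈ℂ w
pointwiseℂ {z} {w} eq eq′ = pointwise {re z} {re w} eq , pointwise {im z} {im w} eq′

*ℂ-cong : ∀ {z z′ w w′} → z ≈ℂ z′ → w ≈ℂ w′ → z *ℂ w ≈ℂ z′ *ℂ w′
*ℂ-cong (re≈ , im≈) (re′≈ , im′≈) =
  +ℝ-cong (*ℝ-cong re≈ re′≈) (-ℝ-cong (*ℝ-cong im≈ im′≈)) ,
  +ℝ-cong (*ℝ-cong re≈ im′≈) (*ℝ-cong im≈ re′≈)

ℂ-commutativeRing : CommutativeRing 0ℓ 0ℓ
ℂ-commutativeRing = record
  { Carrier = ℂ ; _≈_ = _≈ℂ_ ; _+_ = _+ℂ_ ; _*_ = _*ℂ_ ; -_ = -ℂ_ ; 0# = 0ℂ ; 1# = 1ℂ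
  ; isCommutativeRing = record
    { isRing = record
      { +-isAbelianGroup = record
        { isGroup = record
          { isMonoid = record
            { isSemigroup = record
              { isMagma = record
                { isEquivalence = record
                  { refl = ≈ℝ-refl , ≈ℝ-refl
                  ; sym = λ (p , q) → ≈ℝ-sym p , ≈ℝ-sym q
                  ; trans = λ (p , q) (p′ , q′) → ≈ℝ-trans p p′ , ≈ℝ-trans q q′
                  }
                ; ∙-cong = λ (p , q) (p′ , q′) → +ℝ-cong p p′ , +ℝ-cong q q′
                }
              ; assoc = λ x y z → pw (λ k → +-assoc (a x k) (a y k) (a z k))
                                     (λ k → +-assoc (b x k) (b y k) (b z k))
              }
            ; identity = (λ x → pw (λ k → +-identityˡ (a x k)) (λ k → +-identityˡ (b x k)))
                       , (λ x → pw (λ k → +-identityʳ (a x k)) (λ k → +-identityʳ (b x k)))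
            }
          ; inverse = (λ x → pw (λ k → +-inverseˡ (a x k)) (λ k → +-inverseˡ (b x k)))
                    , (λ x → pw (λ k → +-inverseʳ (a x k)) (λ k → +-inverseʳ (b x k)))
          ; ⁻¹-cong = λ (p , q) → -ℝ-cong p , -ℝ-cong q
          }
        ; comm = λ x y → pw (λ k → +-comm (a x k) (a y k)) (λ k → +-comm (b x k) (b y k))
        }
      ; *-cong = *ℂ-cong
      ; *-assoc = λ x y z → pw (λ k → assoc-re (a x k) (b x k) (a y k) (b y k) (a z k) (b z k))
                               (λ k → assoc-im (a x k) (b x k) (a y k) (b y k) (a z k) (b z k))
      ; *-identity = (λ x → pw (λ k → idˡ-re (a x k) (b x k)) (λ k → idˡ-im (a x k) (b x k)))
                   , (λ x → pw (λ k → idʳ-re (a x k) (b x k)) (λ k → idʳ-im (a x k) (b x k)))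
      ; distrib =
          (λ x y z → pw (λ k → distˡ-re (a x k) (b x k) (a y k) (b y k) (a z k) (b z k))
                        (λ k → distˡ-im (a x k) (b x k) (a y k) (b y k) (a z k) (b z k)))
        , (λ x y z → pw (λ k → distʳ-re (a x k) (b x k) (a y k) (b y k) (a z k) (b z k))
                        (λ k → distʳ-im (a x k) (b x k) (a y k) (b y k) (a z k) (b z k)))
      }
    ; *-comm = λ x y → pw (λ k → comm-re (a x k) (b x k) (a y k) (b y k))
                          (λ k → comm-im (a x k) (b x k) (a y k) (b y k))
    }
  }
  where
  a b : ℂ → ℕ → ℚ
  a z k = seq (re z) k
  b z k = seq (im z) k
  pw : ∀ {z w} → (∀ k → a z k ≡ a w k) → (∀ k → b z k ≡ b w k) → z ≈ℂ w
  pw {z} {w} = pointwiseℂ {z} {w}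
  assoc-re : ∀ a b c d e f → (a * c - b * d) * e - (a * d + b * c) * f ≡
    a * (c * e - d * f) - b * (c * f + d * e)
  assoc-re = solve-∀ ℚ-ring
  assoc-im : ∀ a b c d e f → (a * c - b * d) * f + (a * d + b * c) * e ≡
    a * (c * f + d * e) + b * (c * e - d * f)
  assoc-im = solve-∀ ℚ-ring
  idˡ-re : ∀ a b → 1ℚ * a - 0ℚ * b ≡ a
  idˡ-re = solve-∀ ℚ-ring
  idˡ-im : ∀ a b → 1ℚ * b + 0ℚ * a ≡ b
  idˡ-im = solve-∀ ℚ-ring
  idʳ-re : ∀ a b → a * 1ℚ - b * 0ℚ ≡ a
  idʳ-re = solve-∀ ℚ-ring
  idʳ-im : ∀ a b → a * 0ℚ + b * 1ℚ ≡ b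
  idʳ-im = solve-∀ ℚ-ring
  distˡ-re : ∀ a b c d e f → a * (c + e) - b * (d + f) ≡ (a * c - b * d) + (a * e - b * f)
  distˡ-re = solve-∀ ℚ-ring
  distˡ-im : ∀ a b c d e f → a * (d + f) + b * (c + e) ≡ (a * d + b * c) + (a * f + b * e)
  distˡ-im = solve-∀ ℚ-ring
  distʳ-re : ∀ a b c d e f → (c + e) * a - (d + f) * b ≡ (c * a - d * b) + (e * a - f * b)
  distʳ-re = solve-∀ ℚ-ring
  distʳ-im : ∀ a b c d e f → (c + e) * b + (d + f) * a ≡ (c * b + d * a) + (e * b + f * a)
  distʳ-im = solve-∀ ℚ-ring
  comm-re : ∀ a b c d → a * c - b * d ≡ c * a - d * b
  comm-re = solve-∀ ℚ-ring
  comm-im : ∀ a b c d → a * d + b * c ≡ c * b + d * a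
  comm-im = solve-∀ ℚ-ring

open BasisSumProperties ℂ-commutativeRing using (module Adjoint)

conj-+ : ∀ z w → conj (z +ℂ w) ≈ℂ conj z +ℂ conj w
conj-+ z w = ≈ℝ-refl , pointwise λ k → lemma (seq (im z) k) (seq (im w) k)
  where
  lemma : ∀ p q → - (p + q) ≡ - p + - q
  lemma = solve-∀ ℚ-ring

conj-* : ∀ z w → conj (z *ℂ w) ≈ℂ conj z *ℂ conj w
conj-* z w = pointwise (λ k → lemma (seq (re z) k) (seq (im z) k) (seq (re w) k) (seq (im w) k)) ,
  pointwise (λ k → lemma′ (seq (re z) k) (seq (im z) k) (seq (re w) k) (seq (im w) k))
  where
  lemma : ∀ a b c d → a * c - b * d ≡ a * c - (- b) * (- d)
  lemma = solve-∀ ℚ-ring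
  lemma′ : ∀ a b c d → - (a * d + b * c) ≡ a * (- d) + (- b) * c
  lemma′ = solve-∀ ℚ-ring

conj-0 : conj 0ℂ ≈ℂ 0ℂ
conj-0 = ≈ℝ-refl , pointwise λ k → refl

module ℂ-Adjoint {N W} = Adjoint conj conj-+ conj-* conj-0 {N} {W}
open ℂ-Adjoint

module RawSum = RawSemiringDefs (RawRing.rawSemiring ℂ-rawRing)

re-sum : ∀ {n} (g : Fin n → ℂ) k → seq (re (RawSum.sum g)) k ≡ seq (sumℝ (re ∘ g)) k
re-sum {zero}  g k = refl
re-sum {suc n} g k = cong (seq (re (g zero)) k +_) (re-sum (g ∘ suc) k)

-- Norms and amplitudes

seq-sum-cong : ∀ {n} (s t : Fin n → ℝ) k → (∀ i → seq (s i) k ≡ seq (t i) k) →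
  seq (sumℝ s) k ≡ seq (sumℝ t) k
seq-sum-cong {zero}  s t k eq = refl
seq-sum-cong {suc n} s t k eq = cong₂ _+_ (eq zero) (seq-sum-cong (s ∘ suc) (t ∘ suc) k (eq ∘ suc))

module _ {N W : ℕ} where

  seq-normSq : ∀ (ψ : State N W) k → seq (normSq ψ) k ≡ seq (re (inner ψ ψ)) k
  seq-normSq ψ k = sym (trans
    (re-sum (λ i → RawSum.sum (λ w → term (i , false , w)) +ℂ RawSum.sum (λ w → term (i , true , w))) k)
    (seq-sum-cong _ _ k λ i → cong₂ _+_ (half i false) (half i true)))
    where
    term : Basis N W → ℂ
    term s = conj (ψ s) *ℂ ψ s
    lemma : ∀ a b → a * a - (- b) * b ≡ a * a + b * b
    lemma = solve-∀ ℚ-ring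
    half : ∀ i b → seq (re (RawSum.sum (λ w → term (i , b , w)))) k ≡ seq (sumℝ (λ w → ∣ ψ (i , b , w) ∣²)) k
    half i b = trans (re-sum (λ w → term (i , b , w)) k) (seq-sum-cong _ _ k λ w →
      lemma (seq (re (ψ (i , b , w))) k) (seq (im (ψ (i , b , w))) k))

  normSq-inner : ∀ (ψ : State N W) → normSq ψ ≈ℝ re (inner ψ ψ)
  normSq-inner ψ = pointwise (seq-normSq ψ)

  identity-diagonal : ∀ (s : Basis N W) → identity s s ≈ℂ 1ℂ
  identity-diagonal s = subst (λ b → (if b then 1ℂ else 0ℂ) ≈ℂ 1ℂ) (sym (dec-true (s ≟ᴮ s) refl))
    (≈ℝ-refl , ≈ℝ-refl)

  identity-off-diagonal : ∀ (s t : Basis N W) → t ≢ s → identity s t ≈ℂ 0ℂ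
  identity-off-diagonal s t t≢s = subst (λ b → (if b then 1ℂ else 0ℂ) ≈ℂ 0ℂ)
    (sym (dec-false (s ≟ᴮ t) (t≢s ∘ sym))) (≈ℝ-refl , ≈ℝ-refl)

  -- These definitional equalities are used through subst because checking
  -- them below _≈ℂ_ unfolds every sum into its real and imaginary parts.
  ⊙-gram : ∀ (U : Operator N W) s t → ((U †) ⊙ U) s t ≡ gram U s t
  ⊙-gram U s t = refl

  apply-· : ∀ (U : Operator N W) ψ → apply U ψ ≡ U · ψ
  apply-· U ψ = refl

  inner-· : ∀ (U : Operator N W) ψ → inner (apply U ψ) (apply U ψ) ≡ inner (U · ψ) (U · ψ)
  inner-· U ψ = cong (λ φ → inner φ φ) (apply-· U ψ)

  unitary-inner : ∀ {U : Operator N W} → ((U †) ⊙ U) ≈ᴼ identity →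
    ∀ ψ → inner (U · ψ) (U · ψ) ≈ℂ inner ψ ψ
  unitary-inner {U} U†U≈I ψ = subst (_≈ℂ inner ψ ψ) (inner-· U ψ) (isometry {U = U} {I = identity}
    (λ s t → subst (_≈ℂ identity s t) (⊙-gram U s t) (U†U≈I s t))
    identity-diagonal identity-off-diagonal ψ)

  complete-inner : ∀ {M M′ : Operator N W} → (((M †) ⊙ M) +ᴼ ((M′ †) ⊙ M′)) ≈ᴼ identity →
    ∀ ψ → inner (M · ψ) (M · ψ) +ℂ inner (M′ · ψ) (M′ · ψ) ≈ℂ inner ψ ψ
  complete-inner {M} {M′} total≈I ψ = subst₂ (λ p q → p +ℂ q ≈ℂ inner ψ ψ) (inner-· M ψ) (inner-· M′ ψ)
    (complete {U = M} {V = M′} {I = identity}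
      (λ s t → subst₂ (λ p q → p +ℂ q ≈ℂ identity s t) (⊙-gram M s t) (⊙-gram M′ s t) (total≈I s t))
      identity-diagonal identity-off-diagonal ψ)
  normSq-unitary : ∀ {U : Operator N W} → IsUnitary U → ∀ ψ → normSq (U · ψ) ≈ℝ normSq ψ
  normSq-unitary {U} (U†U≈I , _) ψ = ≈ℝ-trans (normSq-inner (U · ψ))
    (≈ℝ-trans (proj₁ (unitary-inner {U} U†U≈I ψ)) (≈ℝ-sym (normSq-inner ψ)))
  normSq-complete : ∀ {M M′ : Operator N W} →
    (((M †) ⊙ M) +ᴼ ((M′ †) ⊙ M′)) ≈ᴼ identity →
    ∀ ψ → normSq (M · ψ) +ℝ normSq (M′ · ψ) ≈ℝ normSq ψ
  normSq-complete {M} {M′} total≈I ψ =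
    ≈ℝ-trans (+ℝ-cong (normSq-inner (M · ψ)) (normSq-inner (M′ · ψ)))
      (≈ℝ-trans (proj₁ (complete-inner {M} {M′} total≈I ψ)) (≈ℝ-sym (normSq-inner ψ)))

  -- A query permutes the basis: for each `i` it either fixes or exchanges the halves with `b` false
  -- and `b` true, so the squares are only reordered.
  normSq-oracle : ∀ x (ψ : State N W) → normSq (oracle x ψ) ≈ℝ normSq ψ
  normSq-oracle x ψ = pointwise λ k → seq-sum-cong _ _ k λ i → query k i (bit (lookup x i))
    where
    query : ∀ k i β →
      seq (sumℝ (λ w → ∣ ψ (i , false xor β , w) ∣²)) k + seq (sumℝ (λ w → ∣ ψ (i , true xor β , w) ∣²)) k ≡
      seq (sumℝ (λ w → ∣ ψ (i , false , w) ∣²)) k + seq (sumℝ (λ w → ∣ ψ (i , true , w) ∣²)) k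
    query k i false = refl
    query k i true  = +-comm (seq (sumℝ (λ w → ∣ ψ (i , true , w) ∣²)) k) _

  record Isometric (U : Operator N W) : Set where
    constructor isometric
    field
      preserves : ∀ ψ → normSq (U · ψ) ≈ℝ normSq ψ

  open Isometric

  run-suc : ∀ T (U : Fin (suc (suc T)) → Operator N W) x ψ →
    U (fromℕ (suc T)) · oracle x (run T (U ∘ inject₁) x ψ) ≡ run (suc T) U x ψ
  run-suc T U x ψ = refl

  run-zero : ∀ (U : Fin 1 → Operator N W) x ψ → U zero · ψ ≡ run 0 U x ψ
  run-zero U x ψ = refl
  normSq-run : ∀ T (U : Fin (suc T) → Operator N W) → (∀ j → Isometric (U j)) →
    ∀ x ψ → normSq (run T U x ψ) ≈ℝ normSq ψ
  normSq-run zero    U iso x ψ = subst (λ φ → normSq φ ≈ℝ normSq ψ) (run-zero U x ψ)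
    (preserves (iso zero) ψ)
  normSq-run (suc T) U iso x ψ = subst (λ φ → normSq φ ≈ℝ normSq ψ) (run-suc T U x ψ)
    (step (run T (U ∘ inject₁) x ψ) (normSq-run T (U ∘ inject₁) (iso ∘ inject₁) x ψ))
    where
    step : ∀ φ → normSq φ ≈ℝ normSq ψ → normSq (U (fromℕ (suc T)) · oracle x φ) ≈ℝ normSq ψ
    step φ φ≈ψ = ≈ℝ-trans {y = normSq (oracle x φ)} {z = normSq ψ}
      (preserves (iso (fromℕ (suc T))) (oracle x φ))
      (≈ℝ-trans {y = normSq φ} {z = normSq ψ} (normSq-oracle x φ) φ≈ψ)

  seq-sum-nonNeg : ∀ {n} (t : Fin n → ℝ) k → (∀ i → 0ℚ ≤ seq (t i) k) → 0ℚ ≤ seq (sumℝ t) k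
  seq-sum-nonNeg {zero}  t k 0≤t = ≤-refl
  seq-sum-nonNeg {suc n} t k 0≤t = 0≤+ (0≤t zero) (seq-sum-nonNeg (t ∘ suc) k (0≤t ∘ suc))

  -- A sum of squares is nonnegative at every index, not just in the limit; the estimate of the bias
  -- is made at a single index and relies on this.
  seq-normSq-nonNeg : ∀ (ψ : State N W) k → 0ℚ ≤ seq (normSq ψ) k
  seq-normSq-nonNeg ψ k = seq-sum-nonNeg _ k λ i →
    0≤+ (seq-sum-nonNeg _ k λ w → square (ψ (i , false , w))) (seq-sum-nonNeg _ k λ w → square (ψ (i , true , w)))
    where
    square : ∀ z → 0ℚ ≤ seq ∣ z ∣² k
    square z = 0≤+ (0≤square (seq (re z) k)) (0≤square (seq (im z) k))

totalProb : ∀ {N} (A : QueryAlgorithm N) x → outputProb A x Sign.+ +ℝ outputProb A x Sign.- ≈ℝ 1ℝ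
totalProb A x = ≈ℝ-trans {y = normSq (finalState A x)}
  (normSq-complete {M = measure A Sign.+} {M′ = measure A Sign.-} (measure-complete A) (finalState A x))
  (subst (λ φ → normSq φ ≈ℝ 1ℝ) final
    (≈ℝ-trans {y = normSq (initial A)}
      (normSq-run (cost A) (unitary A)
        (λ j → isometric (normSq-unitary {U = unitary A j} (unitary-unitary A j))) x (initial A))
      (initial-unit A)))
  where
  final : run (cost A) (unitary A) x (initial A) ≡ finalState A x
  final = refl

-- The polynomial method

-- At the fixed index `k` the amplitudes become pairs of rational functions on the cube with exact
-- polynomial representations.
record HasDegreeℂ≤ {N} (k D : ℕ) (F : Vec Sign N → ℂ) : Set where
  constructor _+iᵈ_
  field
    re-degree : HasDegree≤ D (λ x → seq (re (F x)) k)
    im-degree : HasDegree≤ D (λ x → seq (im (F x)) k)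

open HasDegreeℂ≤

module _ {N : ℕ} (k : ℕ) where

  degree-sumℂ : ∀ {n D} (F : Fin n → Vec Sign N → ℂ) → (∀ i → HasDegreeℂ≤ k D (F i)) →
    HasDegreeℂ≤ k D (λ x → RawSum.sum (λ i → F i x))
  degree-sumℂ {zero}  F pF = degree-const 0ℚ +iᵈ degree-const 0ℚ
  degree-sumℂ {suc n} F pF =
    degree-+ (re-degree (pF zero)) (re-degree rest) +iᵈ degree-+ (im-degree (pF zero)) (im-degree rest)
    where rest = degree-sumℂ (F ∘ suc) (pF ∘ suc)

  degree-sumℝ : ∀ {n D} (F : Fin n → Vec Sign N → ℝ) → (∀ i → HasDegree≤ D (λ x → seq (F i x) k)) →
    HasDegree≤ D (λ x → seq (sumℝ (λ i → F i x)) k)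
  degree-sumℝ {zero}  F pF = degree-const 0ℚ
  degree-sumℝ {suc n} F pF = degree-+ (pF zero) (degree-sumℝ (F ∘ suc) (pF ∘ suc))

  degree-scaleℂ : ∀ {D} u {F : Vec Sign N → ℂ} → HasDegreeℂ≤ k D F → HasDegreeℂ≤ k D (λ x → u *ℂ F x)
  degree-scaleℂ u pF =
    degree-- (scale (seq (re u) k) (re-degree pF)) (scale (seq (im u) k) (im-degree pF)) +iᵈ
    degree-+ (scale (seq (re u) k) (im-degree pF)) (scale (seq (im u) k) (re-degree pF))
    where
    scale : ∀ {D G} q → HasDegree≤ D G → HasDegree≤ D (λ x → q * G x)
    scale q = degree-* (degree-const {D = 0} q)

  module _ {W : ℕ} where

    degree-apply : ∀ {D} (U : Operator N W) {ψ : Vec Sign N → State N W} →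
      (∀ s → HasDegreeℂ≤ k D (λ x → ψ x s)) → ∀ s → HasDegreeℂ≤ k D (λ x → (U · ψ x) s)
    degree-apply {D} U {ψ} pψ s = degree-sumℂ _ λ i →
      degree-+ (re-degree (half i false)) (re-degree (half i true)) +iᵈ
      degree-+ (im-degree (half i false)) (im-degree (half i true))
      where
      half : ∀ i b → HasDegreeℂ≤ k D (λ x → RawSum.sum λ w → U s (i , b , w) *ℂ ψ x (i , b , w))
      half i b = degree-sumℂ _ λ w → degree-scaleℂ (U s (i , b , w)) (pψ (i , b , w))

    -- The factors (1 ± xᵢ)/2 are the indicators of the two values of xᵢ, so choosing between two
    -- polynomials according to one coordinate costs one degree.
    degree-select : ∀ {D} {F G : Vec Sign N → ℚ} i → HasDegree≤ D F → HasDegree≤ D G →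
      HasDegree≤ (suc D) (λ x → ℚ.½ * ((1ℚ + sgn (lookup x i)) * F x + (1ℚ - sgn (lookup x i)) * G x))
    degree-select i pF pG = degree-* (degree-const {D = 0} ℚ.½)
      (degree-+ (degree-* (degree-+ (degree-const 1ℚ) (degree-coordinate i)) pF)
                (degree-* (degree-- (degree-const 1ℚ) (degree-coordinate i)) pG))

    select-xor : ∀ (h : Bool → ℚ) b s →
      h (b xor bit s) ≡ ℚ.½ * ((1ℚ + sgn s) * h b + (1ℚ - sgn s) * h (not b))
    select-xor h b Sign.+ = trans (cong h (xor-false b)) (lemma (h b) (h (not b)))
      where
      xor-false : ∀ b → b xor false ≡ b
      xor-false true  = refl
      xor-false false = refl
      lemma : ∀ p q → p ≡ ℚ.½ * ((1ℚ + 1ℚ) * p + (1ℚ - 1ℚ) * q)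
      lemma = solve-∀ ℚ-ring
    select-xor h b Sign.- = trans (cong h (xor-true b)) (lemma (h b) (h (not b)))
      where
      xor-true : ∀ b → b xor true ≡ not b
      xor-true true  = refl
      xor-true false = refl
      lemma : ∀ p q → q ≡ ℚ.½ * ((1ℚ + - 1ℚ) * p + (1ℚ - - 1ℚ) * q)
      lemma = solve-∀ ℚ-ring

    degree-oracle : ∀ {D} {ψ : Vec Sign N → State N W} →
      (∀ s → HasDegreeℂ≤ k D (λ x → ψ x s)) → ∀ s → HasDegreeℂ≤ k (suc D) (λ x → oracle x (ψ x) s)
    degree-oracle {ψ = ψ} pψ (i , b , w) =
      degree-cong (λ x → select-xor (λ b → seq (re (ψ x (i , b , w))) k) b (lookup x i))
        (degree-select i (re-degree (pψ (i , b , w))) (re-degree (pψ (i , not b , w)))) +iᵈ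
      degree-cong (λ x → select-xor (λ b → seq (im (ψ x (i , b , w))) k) b (lookup x i))
        (degree-select i (im-degree (pψ (i , b , w))) (im-degree (pψ (i , not b , w))))

    -- The unitaries do not depend on `x` and only form linear combinations of amplitudes; each
    -- query adds one degree.
    degree-run : ∀ T (U : Fin (suc T) → Operator N W) ψ s → HasDegreeℂ≤ k T (λ x → run T U x ψ s)
    degree-run zero    U ψ s = degree-const _ +iᵈ degree-const _
    degree-run (suc T) U ψ   = degree-apply (U (fromℕ (suc T)))
      (degree-oracle (degree-run T (U ∘ inject₁) ψ))

    degree-normSq : ∀ {D} {ψ : Vec Sign N → State N W} →
      (∀ s → HasDegreeℂ≤ k D (λ x → ψ x s)) → HasDegree≤ (D ℕ.+ D) (λ x → seq (normSq (ψ x)) k)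
    degree-normSq {D} {ψ} pψ = degree-sumℝ _ λ i → degree-+ (half i false) (half i true)
      where
      half : ∀ i b → HasDegree≤ (D ℕ.+ D) (λ x → seq (sumℝ λ w → ∣ ψ x (i , b , w) ∣²) k)
      half i b = degree-sumℝ _ λ w → degree-+
        (degree-* (re-degree (pψ (i , b , w))) (re-degree (pψ (i , b , w))))
        (degree-* (im-degree (pψ (i , b , w))) (im-degree (pψ (i , b , w))))

  degree-outputProb : ∀ (A : QueryAlgorithm N) v →
    HasDegree≤ (cost A ℕ.+ cost A) (λ x → seq (outputProb A x v) k)
  degree-outputProb A v = degree-normSq {ψ = λ x → measure A v · finalState A x}
    (degree-apply (measure A v) {finalState A} (degree-run (cost A) (unitary A) (initial A)))

-- From query algorithms to polynomials

-- The cube is finite, so the thresholds of its points have a maximum. This supplies one index that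
-- is late enough for all inputs at once.
eventually-uniform : ∀ {N} (Q : Vec Sign N → ℕ → Set) →
  (∀ x → ∃[ K ] (∀ k → K ℕ.≤ k → Q x k)) → ∃[ K ] (∀ x k → K ℕ.≤ k → Q x k)
eventually-uniform {zero}  Q ev = proj₁ (ev []) , λ { [] → proj₂ (ev []) }
eventually-uniform {suc N} Q ev
  with eventually-uniform (Q ∘ (Sign.+ ∷_)) (ev ∘ (Sign.+ ∷_))
     | eventually-uniform (Q ∘ (Sign.- ∷_)) (ev ∘ (Sign.- ∷_))
... | K , q⁺ | L , q⁻ = K ℕ.⊔ L , λ
  { (Sign.+ ∷ x) k ≤k → q⁺ x k (ℕ.m⊔n≤o⇒m≤o K L ≤k)
  ; (Sign.- ∷ x) k ≤k → q⁻ x k (ℕ.m⊔n≤o⇒n≤o K L ≤k)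
  }

p≤∣p∣ : ∀ p → p ≤ ∣ p ∣
p≤∣p∣ p with ℚ.≤-total 0ℚ p
... | inj₁ 0≤p = ≤-reflexive (sym (0≤p⇒∣p∣≡p 0≤p))
... | inj₂ p≤0 = ≤-trans p≤0 (0≤∣p∣ p)

1/100ℚ : ℚ
1/100ℚ = ℤ.+ 1 ℚ./ 100

-- Exact probabilities would give error at most 2/5. With tolerance 1/100, used twice for the
-- correct outcome `p` and once for the total, this becomes 43/100, still below 9/20.
bias-close : ∀ p q → 0ℚ ≤ q → p + q - 1ℚ ≤ 1/100ℚ → 4/5ℚ ≤ p + 1/100ℚ → ∣ 1ℚ - (p - q) ∣ ≤ 9/20ℚ
bias-close p q 0≤q total correct = ∣∣≤
  (≤-by ((q + q) + (1/100ℚ - (p + q - 1ℚ)) + (ℤ.+ 11 ℚ./ 25))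
    (0≤+ (0≤+ (0≤+ 0≤q 0≤q) (0≤-diff total)) (0≤n/d 11 25)) (lower p q))
  (≤-by (((p + 1/100ℚ - 4/5ℚ) + (p + 1/100ℚ - 4/5ℚ)) + (1/100ℚ - (p + q - 1ℚ)) + (ℤ.+ 1 ℚ./ 50))
    (0≤+ (0≤+ (0≤+ (0≤-diff correct) (0≤-diff correct)) (0≤-diff total)) (0≤n/d 1 50)) (upper p q))
  where
  lower : ∀ p q → 1ℚ - (p - q) ≡ - 9/20ℚ + ((q + q) + (1/100ℚ - (p + q - 1ℚ)) + (ℤ.+ 11 ℚ./ 25))
  lower = solve-∀ ℚ-ring
  upper : ∀ p q → 9/20ℚ ≡ 1ℚ - (p - q) +
    (((p + 1/100ℚ - 4/5ℚ) + (p + 1/100ℚ - 4/5ℚ)) + (1/100ℚ - (p + q - 1ℚ)) + (ℤ.+ 1 ℚ./ 50))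
  upper = solve-∀ ℚ-ring

module _ {N : ℕ} (F : BoolFn N) (A : QueryAlgorithm N) (computes : ComputesWithProb (fromℚ 4/5ℚ) A F) where

  prob : ℕ → Vec Sign N → Sign → ℚ
  prob k x v = seq (outputProb A x v) k

  Good : Vec Sign N → ℕ → Set
  Good x k = prob k x Sign.+ + prob k x Sign.- - 1ℚ ≤ 1/100ℚ × 4/5ℚ ≤ prob k x (F x) + 1/100ℚ

  eventually-good : ∀ x → ∃[ K ] (∀ k → K ℕ.≤ k → Good x k)
  eventually-good x = merge
    (eventually≈ (totalProb A x) 1/100ℚ 0<1/100) (eventually≤ (computes x) 1/100ℚ 0<1/100)
    where
    0<1/100 : 0ℚ < 1/100ℚ
    0<1/100 = from-yes (0ℚ ℚ.<? 1/100ℚ)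
    merge :
      ∃[ K ] (∀ k → K ℕ.≤ k → ∣ prob k x Sign.+ + prob k x Sign.- - 1ℚ ∣ < 1/100ℚ) →
      ∃[ L ] (∀ k → L ℕ.≤ k → 4/5ℚ ≤ prob k x (F x) + 1/100ℚ) →
      ∃[ K ] (∀ k → K ℕ.≤ k → Good x k)
    merge (K , total) (L , correct) = K ℕ.⊔ L , λ k ≤k →
      ≤-trans (p≤∣p∣ (prob k x Sign.+ + prob k x Sign.- - 1ℚ)) (<⇒≤ (total k (ℕ.m⊔n≤o⇒m≤o K L ≤k))) ,
      correct k (ℕ.m⊔n≤o⇒n≤o K L ≤k)

  bias : ℕ → Vec Sign N → ℚ
  bias k x = prob k x Sign.+ - prob k x Sign.-

  good⇒close : ∀ x k → Good x k → ∣ sgn (F x) - bias k x ∣ ≤ 9/20ℚ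
  good⇒close x k (total , correct) = by-sign (F x) correct
    where
    p = prob k x Sign.+
    q = prob k x Sign.-
    by-sign : ∀ s → 4/5ℚ ≤ prob k x s + 1/100ℚ → ∣ sgn s - (p - q) ∣ ≤ 9/20ℚ
    0≤prob : ∀ v → 0ℚ ≤ prob k x v
    0≤prob v = seq-normSq-nonNeg (measure A v · finalState A x) k
    by-sign Sign.+ correct = bias-close p q (0≤prob Sign.-) total correct
    by-sign Sign.- correct = subst (_≤ 9/20ℚ) (trans (sym (∣-p∣≡∣p∣ (1ℚ - (q - p)))) (cong ∣_∣ (lemma p q)))
      (bias-close q p (0≤prob Sign.+) (subst (λ t → t - 1ℚ ≤ 1/100ℚ) (+-comm p q) total) correct)
      where
      lemma : ∀ p q → - (1ℚ - (q - p)) ≡ - 1ℚ - (p - q)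
      lemma = solve-∀ ℚ-ring

  approximating-polynomial :
    ∃[ P ] HasDegree≤ (cost A ℕ.+ cost A) P × (∀ x → ∣ sgn (F x) - P x ∣ ≤ 9/20ℚ)
  approximating-polynomial = polynomial (eventually-uniform Good eventually-good)
    where
    polynomial : ∃[ K ] (∀ x k → K ℕ.≤ k → Good x k) →
      ∃[ P ] HasDegree≤ (cost A ℕ.+ cost A) P × (∀ x → ∣ sgn (F x) - P x ∣ ≤ 9/20ℚ)
    polynomial (K , good) = bias K ,
      degree-- (degree-outputProb K A Sign.+) (degree-outputProb K A Sign.-) ,
      λ x → good⇒close x K (good x K ℕ.≤-refl)

-- The lower bound on the cost

sum≤9*sum : ∀ {n} (d d′ : Fin n → ℕ) → (∀ i → d i ℕ.≤ 9 ℕ.* d′ i) → sumℕ d ℕ.≤ 9 ℕ.* sumℕ d′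
sum≤9*sum {zero}  d d′ d≤ = ℕ.z≤n
sum≤9*sum {suc n} d d′ d≤ = subst (sumℕ d ℕ.≤_) (sym (ℕ.*-distribˡ-+ 9 (d′ zero) _))
  (ℕ.+-mono-≤ (d≤ zero) (sum≤9*sum (d ∘ suc) (d′ ∘ suc) (d≤ ∘ suc)))

-- 36 = 9 · 2 · 2: amplification loses 9, the expansion reaches only half of the sum of the degrees,
-- and probabilities are quadratic in the amplitudes.
Σdegree≤36*cost : ∀ {n m} (f : Fin n → BoolFn m) (d : Fin n → ℕ) →
  (∀ i → IsApproxDegree (fromℚ 1/5ℚ) (f i) (d i)) →
  (A : QueryAlgorithm (n ℕ.* m)) → ComputesWithProb (fromℚ 4/5ℚ) A (⨂ f) →
  sumℕ d ℕ.≤ 36 ℕ.* cost A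
Σdegree≤36*cost f d deg A computes = conclude (approximating-polynomial (⨂ f) A computes)
  where
  duals : ∀ i → ∃[ d′ ] d i ℕ.≤ 9 ℕ.* d′ × DualMeasures (f i) d′
  duals i = dualMeasures (deg i)
  d′ = proj₁ ∘ duals
  conclude : ∃[ P ] HasDegree≤ (cost A ℕ.+ cost A) P × (∀ x → ∣ sgn (⨂ f x) - P x ∣ ≤ 9/20ℚ) →
    sumℕ d ℕ.≤ 36 ℕ.* cost A
  conclude (P , pP , close) = begin
    sumℕ d                              ≤⟨ sum≤9*sum d d′ (proj₁ ∘ proj₂ ∘ duals) ⟩
    9 ℕ.* sumℕ d′                       ≤⟨ ℕ.*-monoʳ-≤ 9 (XOR.xor-degree f d′ (proj₂ ∘ proj₂ ∘ duals) pP close) ⟩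
    9 ℕ.* (2 ℕ.* (cost A ℕ.+ cost A))   ≡⟨ lemma (cost A) ⟩
    36 ℕ.* cost A                       ∎
    where
    open ℕ.≤-Reasoning
    lemma : ∀ T → 9 ℕ.* (2 ℕ.* (T ℕ.+ T)) ≡ 36 ℕ.* T
    lemma = ℕSolver.solve-∀

-- Passing to unnormalised fractions exposes the cross-multiplied inequality between natural
-- numbers, which reduction to lowest terms conceals.
1/36-mul : ∀ {a b} → a ℕ.≤ 36 ℕ.* b → (ℤ.+ 1 ℚ./ 36) * (ℤ.+ a ℚ./ 1) ≤ ℤ.+ b ℚ./ 1
1/36-mul {a} {b} a≤36b = toℚᵘ-cancel-≤ (ℚᵘ.≤-respˡ-≃ (ℚᵘ.≃-sym left) (ℚᵘ.≤-respʳ-≃ (ℚᵘ.≃-sym right) main))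
  where
  left : ℚ.toℚᵘ ((ℤ.+ 1 ℚ./ 36) * (ℤ.+ a ℚ./ 1)) ℚᵘ.≃ ℚᵘ.mkℚᵘ (ℤ.+ 1) 35 ℚᵘ.* ℚᵘ.mkℚᵘ (ℤ.+ a) 0
  left = ℚᵘ.≃-trans (toℚᵘ-homo-* (ℤ.+ 1 ℚ./ 36) (ℤ.+ a ℚ./ 1))
    (ℚᵘ.*-congˡ (toℚᵘ-fromℚᵘ (ℚᵘ.mkℚᵘ (ℤ.+ a) 0)))
  right : ℚ.toℚᵘ (ℤ.+ b ℚ./ 1) ℚᵘ.≃ ℚᵘ.mkℚᵘ (ℤ.+ b) 0
  right = toℚᵘ-fromℚᵘ (ℚᵘ.mkℚᵘ (ℤ.+ b) 0)
  main : ℚᵘ.mkℚᵘ (ℤ.+ 1) 35 ℚᵘ.* ℚᵘ.mkℚᵘ (ℤ.+ a) 0 ℚᵘ.≤ ℚᵘ.mkℚᵘ (ℤ.+ b) 0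
  main = ℚᵘ.*≤* (subst₂ ℤ._≤_ (sym (trans (ℤ.*-identityʳ _) (ℤ.*-identityˡ (ℤ.+ a)))) (ℤ.pos-* b 36)
    (ℤ.+≤+ (subst (a ℕ.≤_) (ℕ.*-comm 36 b) a≤36b)))

theorem1p4 : ∃[ c ] 0ℝ <ℝ c ×
    (∀ (n m : ℕ) → 1 ℕ.≤ n → 1 ℕ.≤ m →
    (f : Fin n → BoolFn m) (d : Fin n → ℕ) →
    (∀ i → IsApproxDegree (fromℚ (ℤ.+ 1 ℚ./ 5)) (f i) (d i)) →
    (A : QueryAlgorithm (n ℕ.* m)) →
    ComputesWithProb (fromℚ (ℤ.+ 4 ℚ./ 5)) A (⨂ f) →
    c *ℝ fromℕℝ (sumℕ d) ≤ℝ fromℕℝ (cost A))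
theorem1p4 = fromℚ 1/36 , mk<ℝ (1/36 , from-yes (0ℚ ℚ.<? 1/36) , 0 , λ _ _ → ≤-reflexive (+-identityˡ 1/36)) ,
  λ n m _ _ f d deg A computes → mk≤ℝ λ ε 0<ε → 0 , λ _ _ →
    ≤-trans (1/36-mul {sumℕ d} {cost A} (Σdegree≤36*cost f d deg A computes)) (≤-by ε (<⇒≤ 0<ε) refl)
  where
  1/36 : ℚ
  1/36 = ℤ.+ 1 ℚ./ 36
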